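{- Let $G$ be a finite non-solvable group. Then $G$ admits an irredundant generating set $\{a_1,\ldots,a_d\}$ with $$|a_1|,\ldots,|a_d|,\ |a_2a_1^{ -1}|,\ldots,|a_d a_{d-1}^{ -1}|>2.$$ In particular, $G$ admits an oriented regular representation (ORR).
   Context: $|g|$ denotes the order of $g$. A generating set $S$ of $G$ is irredundant if for every $s\in S$ the set $S\setminus\{s\}$ does not generate $G$. For a subset $S\subseteq G$, the Cayley digraph $\mathrm{Cay}(G,S)$ has vertex set $G$, and $(x,y)$ is an arc iff $yx^{ -1}\in S$; $G$ acts on it by right multiplication. $G$ admits an ORR if there is a subset $S\subseteq G$ with $S\cap S^{ -1}=\emptyset$ such that the full automorphism group of $\mathrm{Cay}(G,S)$ equals (the right regular representation of) $G$. -}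

module Defs where

open import Level using (0ℓ)
open import Data.Nat using (ℕ; zero; suc; _<_; _≤_)
open import Data.Fin using (Fin; toℕ)
open import Data.Fin.Subset using (Subset; _∈_; _∉_)
open import Data.Fin.Permutation using (Permutation′; _⟨$⟩ʳ_)
open import Data.Product using (Σ; ∃; ∃-syntax; _×_; _,_)
open import Data.Unit using (⊤)
open import Data.Empty using (⊥)
open import Relation.Nullary using (¬_)
open import Relation.Binary.PropositionalEquality using (_≡_; _≢_)
open import Function.Bundles using (_⇔_)
open import Function.Definitions using (Injective)
open import Algebra.Structures using (IsGroup)

-- A finite group, presented on the carrier Fin n (every finite group is
-- isomorphic to one of these), with the library's IsGroup structure
-- w.r.t. propositional equality.
record FinGroup : Set where
  field
    n       : ℕ
    _∙_     : Fin n → Fin n → Fin n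
    ε       : Fin n
    _⁻¹     : Fin n → Fin n
    isGroup : IsGroup _≡_ _∙_ ε _⁻¹
  infixl 7 _∙_
  infix 8 _⁻¹

module _ (G : FinGroup) where
  open FinGroup G

  pow : Fin n → ℕ → Fin n
  pow g zero    = ε
  pow g (suc k) = g ∙ pow g k

  HasOrder : Fin n → ℕ → Set
  HasOrder g k = (1 ≤ k) × (pow g k ≡ ε) × (∀ m → 1 ≤ m → m < k → pow g m ≢ ε)

  OrderGT2 : Fin n → Set
  OrderGT2 g = ∃[ k ] (HasOrder g k × 2 < k)

  data Gen (S : Fin n → Set) : Fin n → Set where
    gen-base : ∀ {g} → S g → Gen S g
    gen-ε    : Gen S ε
    gen-mul  : ∀ {g h} → Gen S g → Gen S h → Gen S (g ∙ h)
    gen-inv  : ∀ {g} → Gen S g → Gen S (g ⁻¹)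

  Generates : (Fin n → Set) → Set
  Generates S = ∀ g → Gen S g

  IrredundantGenSet : (Fin n → Set) → Set
  IrredundantGenSet S =
    Generates S × (∀ s → S s → ¬ Generates (λ g → S g × g ≢ s))

  comm : Fin n → Fin n → Fin n
  comm x y = x ⁻¹ ∙ y ⁻¹ ∙ x ∙ y

  derived : ℕ → Fin n → Set
  derived zero    g = ⊤
  derived (suc k) g =
    Gen (λ z → ∃[ x ] ∃[ y ] (derived k x × derived k y × z ≡ comm x y)) g

  Solvable : Set
  Solvable = ∃[ k ] (∀ g → derived k g → g ≡ ε)

  Arc : Subset n → Fin n → Fin n → Set
  Arc S x y = (y ∙ x ⁻¹) ∈ S

  IsCayAut : Subset n → Permutation′ n → Set
  IsCayAut S π = ∀ x y → Arc S x y ⇔ Arc S (π ⟨$⟩ʳ x) (π ⟨$⟩ʳ y)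

  -- Aut(Cay(G,S)) equals the right regular representation of G
  -- (right translations are always automorphisms, so it suffices that
  -- every automorphism is a right translation x ↦ x g)
  AutIsRegular : Subset n → Set
  AutIsRegular S = ∀ π → IsCayAut S π → ∃[ g ] (∀ x → π ⟨$⟩ʳ x ≡ x ∙ g)

  AdmitsORR : Set
  AdmitsORR = ∃[ S ] ((∀ g → g ∈ S → g ⁻¹ ∉ S) × AutIsRegular S)

  Range : ∀ {d} → (Fin d → Fin n) → Fin n → Set
  Range a g = ∃[ i ] (a i ≡ g)

  GoodGenSeq : ∀ {d} → (Fin d → Fin n) → Set
  GoodGenSeq {d} a =
    Injective _≡_ _≡_ a
    × IrredundantGenSet (Range a)
    × (∀ i → OrderGT2 (a i))
    × (∀ (i j : Fin d) → toℕ j ≡ suc (toℕ i) → OrderGT2 (a j ∙ a i ⁻¹))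

{-# OPTIONS --safe #-}

-- Let R be the solvable radical, so that an element commuting modulo R with all its
-- conjugates lies in R. Suppose G = ⟨K, g⟩ and z ∈ K, and that z commutes modulo R with y²
-- for every y ∈ KgK. As z is then centralized by (yh)² for y ∈ KgK and h ∈ K, the conjugacy
-- class of z modulo R is z^K ∪ z^(KgK), and z commutes with all of it, so z ∈ R.
-- Consequently the generators can be replaced one at a time, g by some y ∈ KgK, so that
-- [aᵢ², aᵢ₊₁²] ∉ R throughout; passing from y to y⁻¹ if need be, also (aᵢ₊₁aᵢ⁻¹)² ≠ 1.
-- Dropping redundant generators and starting over makes the sequence irredundant.
--
-- For the ORR take S = {aᵢ} ∪ {aᵢ₊₁aᵢ⁻¹}. In an equation uv = w between elements of S no aᵢ
-- is expressible by the others, and squares of consecutive aᵢ do not commute; this leaves only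
-- (aᵢ₊₁aᵢ⁻¹)aᵢ = aᵢ₊₁. So S induces a directed path a₁ → a₂ → ⋯ and isolated vertices, and an
-- automorphism fixing x fixes every aᵢx.
module Submission where

open import Defs
open import Data.Nat using (ℕ; zero; suc; _+_; _<_; _≤_; s≤s; z≤n)
open import Data.Fin using (Fin; zero; suc; toℕ; fromℕ; inject₁; punchIn; punchOut)
open import Data.Product using (∃-syntax; _×_; _,_; proj₁; proj₂)
open import Relation.Nullary using (¬_; Dec; yes; no; does; ¬?; _×-dec_; _⊎-dec_; contradiction)
open import Level using (0ℓ; _⊔_)
open import Algebra.Bundles using (Group)
open import Data.Bool using (Bool; true; false; not)
import Data.Bool.Properties as Bool
open import Data.Empty using (⊥; ⊥-elim)
open import Data.Fin.Induction using (<-weakInduction)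
open import Data.Fin.Permutation using (_⟨$⟩ʳ_)
import Data.Fin.Properties as Fin
open import Data.Fin.Properties
  using (any?; all?; toℕ-injective; toℕ-inject₁; toℕ-fromℕ; toℕ<n; pigeonhole; punchIn-punchOut)
open import Data.Fin.Subset using (Subset; _∈_; _∉_; _⊂_; _∪_; ⁅_⁆) renaming (⊥ to ∅)
open import Data.Fin.Subset.Induction using (Acc; acc; ⊃-wellFounded)
open import Data.Fin.Subset.Properties
  using (_∈?_; p⊆p∪q; x∈p∪q⁻; x∈p∪q⁺; x∈⁅x⁆; x∈⁅y⁆⇒x≡y; ∉⊥)
import Data.List as List
open import Data.List using (List; []; _∷_; _++_; length)
import Data.List.Membership.DecPropositional as DecList
open import Data.List.Membership.Propositional using (find; lose) renaming (_∈_ to _∈ˡ_)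
open import Data.List.Membership.Propositional.Properties using (∈-tabulate⁺; ∈-allFin; ∈-lookup)
open import Data.List.Properties using (length-tabulate)
open import Data.List.Relation.Binary.Permutation.Propositional using (↭-sym)
open import Data.List.Relation.Binary.Permutation.Propositional.Properties
  using (∈-resp-↭; shift; ∷↭∷ʳ)
open import Data.List.Relation.Unary.All as All using (All; []; _∷_)
open import Data.List.Relation.Unary.Any using (here; there; index) renaming (any? to anyList?)
open import Data.List.Relation.Unary.Any.Properties using (lookup-index)
open import Data.List.Relation.Unary.Linked using (Linked; [-]; _∷_)
import Data.Nat as ℕ
import Data.Nat.Properties as ℕ
open import Data.Product.Properties using (≡-dec)
open import Data.Sum as Sum using (_⊎_; inj₁; inj₂; [_,_])
import Data.Vec as Vec
open import Data.Vec.Properties using (lookup∘tabulate; []=⇒lookup; lookup⇒[]=)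
open import Function using (_∘_; Equivalence)
import Relation.Binary.Reflection as Reflection
import Relation.Binary.PropositionalEquality as ≡
open ≡ using (_≡_; _≢_)
open import Relation.Nullary.Decidable using (map′; dec-true; decidable-stable)
open import Relation.Unary using (Decidable)

-- Group identities by normalization in the free group

module GroupSolver {c ℓ} (H : Group c ℓ) where
  open Group H
  open import Algebra.Properties.Group H
  open import Relation.Binary.Reasoning.Setoid setoid

  infixl 7 _⊕_
  infix 8 ⊖_

  data Expr (m : ℕ) : Set where
    var  : Fin m → Expr m
    id   : Expr m
    _⊕_  : Expr m → Expr m → Expr m
    ⊖_   : Expr m → Expr m

  Env : ℕ → Set c
  Env = Vec.Vec Carrier

  ⟦_⟧ : ∀ {m} → Expr m → Env m → Carrier
  ⟦ var i ⟧ ρ = Vec.lookup ρ i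
  ⟦ id ⟧    ρ = ε
  ⟦ e ⊕ f ⟧ ρ = ⟦ e ⟧ ρ ∙ ⟦ f ⟧ ρ
  ⟦ ⊖ e ⟧   ρ = ⟦ e ⟧ ρ ⁻¹

  Letter : ℕ → Set
  Letter m = Bool × Fin m

  flip : ∀ {m} → Letter m → Letter m
  flip (b , i) = not b , i

  signed : Bool → Carrier → Carrier
  signed true  x = x
  signed false x = x ⁻¹

  ⟦_⟧ₗ : ∀ {m} → Letter m → Env m → Carrier
  ⟦ b , i ⟧ₗ ρ = signed b (Vec.lookup ρ i)

  ⟦_⟧ʷ : ∀ {m} → List (Letter m) → Env m → Carrier
  ⟦ [] ⟧ʷ    ρ = ε
  ⟦ l ∷ w ⟧ʷ ρ = ⟦ l ⟧ₗ ρ ∙ ⟦ w ⟧ʷ ρ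

  push : ∀ {m} → Letter m → List (Letter m) → List (Letter m)
  push l [] = l ∷ []
  push l (l′ ∷ w) with ≡-dec Bool._≟_ Fin._≟_ l (flip l′)
  ... | yes _ = w
  ... | no  _ = l ∷ l′ ∷ w

  -- The flag is the sign of an exponent: the word of `e` or of its inverse is put in front of the
  -- accumulator `w`, with cancellation. Pushing the sign down to the variables reverses products
  -- under an inverse without a separate pass.
  append : ∀ {m} → Expr m → Bool → List (Letter m) → List (Letter m)
  append (var i) b     w = push (b , i) w
  append id      b     w = w
  append (e ⊕ f) true  w = append e true (append f true w)
  append (e ⊕ f) false w = append f false (append e false w)
  append (⊖ e)   b     w = append e (not b) w

  signed-not : ∀ b x → signed (not b) x ∙ signed b x ≈ ε
  signed-not true  x = inverseˡ x
  signed-not false x = inverseʳ x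

  push-correct : ∀ {m} (l : Letter m) w ρ → ⟦ push l w ⟧ʷ ρ ≈ ⟦ l ⟧ₗ ρ ∙ ⟦ w ⟧ʷ ρ
  push-correct l [] ρ = refl
  push-correct l ((b , i) ∷ w) ρ with ≡-dec Bool._≟_ Fin._≟_ l (flip (b , i))
  ... | no  _ = refl
  ... | yes ≡.refl = sym (begin
    signed (not b) x ∙ (signed b x ∙ y)  ≈⟨ assoc _ _ _ ⟨
    signed (not b) x ∙ signed b x ∙ y    ≈⟨ ∙-congʳ (signed-not b x) ⟩
    ε ∙ y                                ≈⟨ identityˡ y ⟩
    y                                    ∎)
    where
    x y : Carrier
    x = Vec.lookup ρ i
    y = ⟦ w ⟧ʷ ρ

  append-correct : ∀ {m} (e : Expr m) b w ρ →
                   ⟦ append e b w ⟧ʷ ρ ≈ signed b (⟦ e ⟧ ρ) ∙ ⟦ w ⟧ʷ ρ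
  append-correct (var i) b w ρ = push-correct (b , i) w ρ
  append-correct id true  w ρ = sym (identityˡ _)
  append-correct id false w ρ = sym (trans (∙-congʳ ε⁻¹≈ε) (identityˡ _))
  append-correct (e ⊕ f) true w ρ = begin
    _                                ≈⟨ append-correct e true _ ρ ⟩
    ⟦ e ⟧ ρ ∙ _                      ≈⟨ ∙-congˡ (append-correct f true w ρ) ⟩
    ⟦ e ⟧ ρ ∙ (⟦ f ⟧ ρ ∙ ⟦ w ⟧ʷ ρ)   ≈⟨ assoc _ _ _ ⟨
    ⟦ e ⟧ ρ ∙ ⟦ f ⟧ ρ ∙ ⟦ w ⟧ʷ ρ     ∎
  append-correct (e ⊕ f) false w ρ = begin
    _                                    ≈⟨ append-correct f false _ ρ ⟩
    ⟦ f ⟧ ρ ⁻¹ ∙ _                       ≈⟨ ∙-congˡ (append-correct e false w ρ) ⟩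
    ⟦ f ⟧ ρ ⁻¹ ∙ (⟦ e ⟧ ρ ⁻¹ ∙ ⟦ w ⟧ʷ ρ) ≈⟨ assoc _ _ _ ⟨
    ⟦ f ⟧ ρ ⁻¹ ∙ ⟦ e ⟧ ρ ⁻¹ ∙ ⟦ w ⟧ʷ ρ   ≈⟨ ∙-congʳ (⁻¹-anti-homo-∙ _ _) ⟨
    (⟦ e ⟧ ρ ∙ ⟦ f ⟧ ρ) ⁻¹ ∙ ⟦ w ⟧ʷ ρ    ∎
  append-correct (⊖ e) true  w ρ = append-correct e false w ρ
  append-correct (⊖ e) false w ρ =
    trans (append-correct e true w ρ) (∙-congʳ (sym (⁻¹-involutive _)))

  ⟦_⇓⟧ : ∀ {m} → Expr m → Env m → Carrier
  ⟦ e ⇓⟧ ρ = ⟦ append e true [] ⟧ʷ ρ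

  correct : ∀ {m} (e : Expr m) ρ → ⟦ e ⇓⟧ ρ ≈ ⟦ e ⟧ ρ
  correct e ρ = trans (append-correct e true [] ρ) (identityʳ _)

  open Reflection setoid var ⟦_⟧ ⟦_⇓⟧ correct public using (solve; _⊜_)

-- Commuting elements and conjugates

module Commutation {c ℓ} (H : Group c ℓ) where
  open Group H
  open GroupSolver H
  open import Relation.Binary.Reasoning.Setoid setoid

  infixl 8 _^_
  _^_ : Carrier → Carrier → Carrier
  z ^ q = q ⁻¹ ∙ z ∙ q

  Comm : Carrier → Carrier → Set ℓ
  Comm x y = x ∙ y ≈ y ∙ x

  comm-resp : ∀ {x x′ y y′} → x ≈ x′ → y ≈ y′ → Comm x y → Comm x′ y′
  comm-resp p q xy = trans (∙-cong (sym p) (sym q)) (trans xy (∙-cong q p))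

  comm-ε : ∀ x → Comm x ε
  comm-ε x = trans (identityʳ x) (sym (identityˡ x))

  comm-∙ : ∀ {x y z} → Comm x y → Comm x z → Comm x (y ∙ z)
  comm-∙ {x} {y} {z} xy xz = begin
    x ∙ (y ∙ z)  ≈⟨ assoc x y z ⟨
    x ∙ y ∙ z    ≈⟨ ∙-congʳ xy ⟩
    y ∙ x ∙ z    ≈⟨ assoc y x z ⟩
    y ∙ (x ∙ z)  ≈⟨ ∙-congˡ xz ⟩
    y ∙ (z ∙ x)  ≈⟨ assoc y z x ⟨
    y ∙ z ∙ x    ∎

  comm-⁻¹ : ∀ {x y} → Comm x y → Comm x (y ⁻¹)
  comm-⁻¹ {x} {y} xy = begin
    x ∙ y ⁻¹               ≈⟨ solve 2 (λ x y → x ⊕ ⊖ y ⊜ ⊖ y ⊕ (y ⊕ x) ⊕ ⊖ y) refl x y ⟩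
    y ⁻¹ ∙ (y ∙ x) ∙ y ⁻¹  ≈⟨ ∙-congʳ (∙-congˡ xy) ⟨
    y ⁻¹ ∙ (x ∙ y) ∙ y ⁻¹  ≈⟨ solve 2 (λ x y → ⊖ y ⊕ (x ⊕ y) ⊕ ⊖ y ⊜ ⊖ y ⊕ x) refl x y ⟩
    y ⁻¹ ∙ x               ∎

  ^-congʳ : ∀ {x y} q → x ≈ y → x ^ q ≈ y ^ q
  ^-congʳ q p = ∙-congʳ (∙-congˡ p)

  comm-^ : ∀ q {x y} → Comm x y → Comm (x ^ q) (y ^ q)
  comm-^ q {x} {y} xy = trans (^-∙ x y) (trans (^-congʳ q xy) (sym (^-∙ y x)))
    where
    ^-∙ : ∀ x y → (x ^ q) ∙ (y ^ q) ≈ (x ∙ y) ^ q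
    ^-∙ x y = solve 3 (λ x y q → (⊖ q ⊕ x ⊕ q) ⊕ (⊖ q ⊕ y ⊕ q) ⊜ ⊖ q ⊕ (x ⊕ y) ⊕ q) refl x y q

  comm⇒^ : ∀ {z c} → Comm z c → z ^ c ≈ z
  comm⇒^ {z} {c} zc = begin
    c ⁻¹ ∙ z ∙ c    ≈⟨ assoc _ _ _ ⟩
    c ⁻¹ ∙ (z ∙ c)  ≈⟨ ∙-congˡ zc ⟩
    c ⁻¹ ∙ (c ∙ z)  ≈⟨ solve 2 (λ z c → ⊖ c ⊕ (c ⊕ z) ⊜ z) refl z c ⟩
    z               ∎

  ^-congˡ : ∀ z {q r} → q ≈ r → z ^ q ≈ z ^ r
  ^-congˡ z p = ∙-cong (∙-congʳ (⁻¹-cong p)) p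

  ^-^ : ∀ z q r → z ^ q ^ r ≈ z ^ (q ∙ r)
  ^-^ = solve 3 (λ z q r → ⊖ r ⊕ (⊖ q ⊕ z ⊕ q) ⊕ r ⊜ ⊖ (q ⊕ r) ⊕ z ⊕ (q ⊕ r)) refl

  -- The two hypotheses together say that conjugation by `x` inverts `y ∙ y`; conjugating twice,
  -- `x ∙ x` centralizes it.
  squares-commute : ∀ {x y} → (x ∙ y) ∙ (x ∙ y) ≈ ε → (x ∙ y ⁻¹) ∙ (x ∙ y ⁻¹) ≈ ε →
                    Comm (x ∙ x) (y ∙ y)
  squares-commute {x} {y} p q = begin
    x ∙ x ∙ (y ∙ y)
      ≈⟨ solve 2 (λ x y → x ⊕ x ⊕ (y ⊕ y) ⊜ x ⊕ (x ⊕ (y ⊕ y) ⊕ ⊖ x) ⊕ ⊖ x ⊕ (x ⊕ x)) refl x y ⟩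
    x ∙ (x ∙ (y ∙ y) ∙ x ⁻¹) ∙ x ⁻¹ ∙ (x ∙ x)
      ≈⟨ ∙-congʳ (∙-congʳ (∙-congˡ inverted)) ⟩
    x ∙ (y ∙ y) ⁻¹ ∙ x ⁻¹ ∙ (x ∙ x)
      ≈⟨ ∙-congʳ (solve 2 (λ x y → x ⊕ ⊖ (y ⊕ y) ⊕ ⊖ x ⊜ ⊖ (x ⊕ (y ⊕ y) ⊕ ⊖ x)) refl x y) ⟩
    (x ∙ (y ∙ y) ∙ x ⁻¹) ⁻¹ ∙ (x ∙ x)
      ≈⟨ ∙-congʳ (⁻¹-cong inverted) ⟩
    (y ∙ y) ⁻¹ ⁻¹ ∙ (x ∙ x)
      ≈⟨ solve 2 (λ x y → ⊖ ⊖ (y ⊕ y) ⊕ (x ⊕ x) ⊜ y ⊕ y ⊕ (x ⊕ x)) refl x y ⟩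
    y ∙ y ∙ (x ∙ x)  ∎
    where
    inverted : x ∙ (y ∙ y) ∙ x ⁻¹ ≈ (y ∙ y) ⁻¹
    inverted = begin
      x ∙ (y ∙ y) ∙ x ⁻¹
        ≈⟨ solve 2 (λ x y → x ⊕ (y ⊕ y) ⊕ ⊖ x
             ⊜ ⊖ (x ⊕ y) ⊕ ((x ⊕ y) ⊕ (x ⊕ y)) ⊕ ⊖ ((x ⊕ ⊖ y) ⊕ (x ⊕ ⊖ y)) ⊕ (x ⊕ ⊖ y)) refl x y ⟩
      (x ∙ y) ⁻¹ ∙ ((x ∙ y) ∙ (x ∙ y)) ∙ ((x ∙ y ⁻¹) ∙ (x ∙ y ⁻¹)) ⁻¹ ∙ (x ∙ y ⁻¹)
        ≈⟨ ∙-congʳ (∙-cong (∙-congˡ p) (⁻¹-cong q)) ⟩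
      (x ∙ y) ⁻¹ ∙ ε ∙ ε ⁻¹ ∙ (x ∙ y ⁻¹)
        ≈⟨ solve 2 (λ x y → ⊖ (x ⊕ y) ⊕ id ⊕ ⊖ id ⊕ (x ⊕ ⊖ y) ⊜ ⊖ (y ⊕ y)) refl x y ⟩
      (y ∙ y) ⁻¹  ∎

-- Squares in a double coset KgK

module DoubleCoset {c ℓ} (H : Group c ℓ) where
  open Group H
  open GroupSolver H
  open Commutation H
  open import Relation.Binary.Reasoning.Setoid setoid

  module CommutingSquares {k} (K : Carrier → Set k)
    (K-ε : K ε) (K-∙ : ∀ {x y} → K x → K y → K (x ∙ y)) (K-⁻¹ : ∀ {x} → K x → K (x ⁻¹))
    (g z : Carrier) (z∈K : K z)
    (commuting : ∀ {h h′} → K h → K h′ → Comm z ((h ∙ g ∙ h′) ∙ (h ∙ g ∙ h′))) where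

    -- The double coset KgK, taken up to `≈`: the group is going to be a quotient of `G`, while `K`
    -- is a predicate that need not respect `≈`.
    Y : Carrier → Set _
    Y y = ∃[ h ] ∃[ h′ ] K h × K h′ × y ≈ h ∙ g ∙ h′

    Y-∙ʳ : ∀ {y h} → Y y → K h → Y (y ∙ h)
    Y-∙ʳ (a , b , a∈K , b∈K , p) h∈K =
      a , _ , a∈K , K-∙ b∈K h∈K , trans (∙-congʳ p) (assoc _ _ _)

    Y-∙ˡ : ∀ {y h} → K h → Y y → Y (h ∙ y)
    Y-∙ˡ {h = h} h∈K (a , b , a∈K , b∈K , p) =
      _ , b , K-∙ h∈K a∈K , b∈K ,
      trans (∙-congˡ p) (solve 4 (λ h a g b → h ⊕ (a ⊕ g ⊕ b) ⊜ h ⊕ a ⊕ g ⊕ b) refl h a g b)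

    g∈Y : Y g
    g∈Y = ε , ε , K-ε , K-ε , solve 1 (λ g → g ⊜ id ⊕ g ⊕ id) refl g

    comm-z-y² : ∀ {y} → Y y → Comm z (y ∙ y)
    comm-z-y² (a , b , a∈K , b∈K , p) = comm-resp refl (sym (∙-cong p p)) (commuting a∈K b∈K)

    -- C is the centralizer of the normal closure of z in K.
    C : Carrier → Set _
    C c = ∀ {h} → K h → Comm (z ^ h) c

    -- For h in K the element hyh⁻¹ lies in KgK again, so z commutes with hy²h⁻¹; conjugate this by
    -- h.
    C-y² : ∀ {y} → Y y → C (y ∙ y)
    C-y² {y} y∈Y {h} h∈K =
      comm-resp refl
        (solve 2 (λ h y → ⊖ h ⊕ ((h ⊕ y ⊕ ⊖ h) ⊕ (h ⊕ y ⊕ ⊖ h)) ⊕ h ⊜ y ⊕ y) refl h y)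
        (comm-^ h (comm-z-y² (Y-∙ʳ (Y-∙ˡ h∈K y∈Y) (K-⁻¹ h∈K))))

    C-∙ : ∀ {x y} → C x → C y → C (x ∙ y)
    C-∙ p q h∈K = comm-∙ (p h∈K) (q h∈K)

    C-⁻¹ : ∀ {x} → C x → C (x ⁻¹)
    C-⁻¹ p h∈K = comm-⁻¹ (p h∈K)

    C-resp : ∀ {x y} → x ≈ y → C x → C y
    C-resp p c h∈K = comm-resp refl p (c h∈K)

    ^ε : ∀ w → w ^ ε ≈ w
    ^ε = solve 1 (λ w → ⊖ id ⊕ w ⊕ id ⊜ w) refl

    -- zʸ = y⁻² (yz)² z⁻¹, where y and yz both lie in KgK, so each factor commutes with z.
    comm-z-zʸ : ∀ {y} → Y y → Comm z (z ^ y)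
    comm-z-zʸ {y} y∈Y = comm-resp refl
      (solve 2 (λ y z → ⊖ (y ⊕ y) ⊕ ((y ⊕ z) ⊕ (y ⊕ z)) ⊕ ⊖ z ⊜ ⊖ y ⊕ z ⊕ y) refl y z)
      (comm-∙ (comm-∙ (comm-⁻¹ (comm-z-y² y∈Y)) (comm-z-y² (Y-∙ʳ y∈Y z∈K))) (comm-⁻¹ refl))

    C-zʸ : ∀ {y} → Y y → C (z ^ y)
    C-zʸ {y} y∈Y {h} h∈K = comm-resp refl
      (solve 3 (λ h y z → ⊖ h ⊕ (⊖ (y ⊕ ⊖ h) ⊕ z ⊕ (y ⊕ ⊖ h)) ⊕ h ⊜ ⊖ y ⊕ z ⊕ y) refl h y z)
      (comm-^ h (comm-z-zʸ (Y-∙ʳ y∈Y (K-⁻¹ h∈K))))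

    -- z = (z^g)⁻¹ g⁻² (gz)² is a product of elements of `C`. Thus z commutes with all its
    -- conjugates under K.
    C-z : C z
    C-z = C-resp
      (solve 2 (λ g z → ⊖ (⊖ g ⊕ z ⊕ g) ⊕ ⊖ (g ⊕ g) ⊕ ((g ⊕ z) ⊕ (g ⊕ z)) ⊜ z) refl g z)
      (C-∙ (C-∙ (C-⁻¹ (C-zʸ g∈Y)) (C-⁻¹ (C-y² g∈Y))) (C-y² (Y-∙ʳ g∈Y z∈K)))

    -- z^(yhy) = z^(h⁻¹), because yhy = (yh)² h⁻¹ and (yh)² centralizes z.
    ^-yhy : ∀ {y h} → Y y → K h → z ^ (y ∙ h ∙ y) ≈ z ^ (h ⁻¹)
    ^-yhy {y} {h} y∈Y h∈K = begin
      z ^ (y ∙ h ∙ y)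
        ≈⟨ solve 3 (λ y h z → ⊖ (y ⊕ h ⊕ y) ⊕ z ⊕ (y ⊕ h ⊕ y)
             ⊜ ⊖ ⊖ h ⊕ (⊖ ((y ⊕ h) ⊕ (y ⊕ h)) ⊕ z ⊕ ((y ⊕ h) ⊕ (y ⊕ h))) ⊕ ⊖ h) refl y h z ⟩
      z ^ ((y ∙ h) ∙ (y ∙ h)) ^ (h ⁻¹)
        ≈⟨ ^-congʳ (h ⁻¹) (comm⇒^ (comm-z-y² (Y-∙ʳ y∈Y h∈K))) ⟩
      z ^ (h ⁻¹)  ∎

    -- The conjugacy class of z in the group generated by K and g.
    data Orbit (w : Carrier) : Set (c ⊔ ℓ ⊔ k) where
      byK : ∀ {h} → K h → w ≈ z ^ h → Orbit w
      byY : ∀ {y} → Y y → w ≈ z ^ y → Orbit w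

    orbit-resp : ∀ {w w′} → w ≈ w′ → Orbit w → Orbit w′
    orbit-resp p (byK h∈K q) = byK h∈K (trans (sym p) q)
    orbit-resp p (byY y∈Y q) = byY y∈Y (trans (sym p) q)

    orbit-z : Orbit z
    orbit-z = byK K-ε (sym (^ε z))

    orbit-K : ∀ {w h} → K h → Orbit w → Orbit (w ^ h)
    orbit-K {h = h} h∈K (byK a∈K p) = byK (K-∙ a∈K h∈K) (trans (^-congʳ h p) (^-^ z _ h))
    orbit-K {h = h} h∈K (byY y∈Y p) = byY (Y-∙ʳ y∈Y h∈K) (trans (^-congʳ h p) (^-^ z _ h))

    orbit-g : ∀ {w} → Orbit w → Orbit (w ^ g)
    orbit-g (byK a∈K p) = byY (Y-∙ˡ a∈K g∈Y) (trans (^-congʳ g p) (^-^ z _ g))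
    -- Here agbg = (ag)(ba⁻¹)(ag) has the shape yhy, so `^-yhy` leads back into z^K.
    orbit-g {w} (byY {y} (a , b , a∈K , b∈K , q) p) =
      byK (K-⁻¹ (K-∙ b∈K (K-⁻¹ a∈K))) (begin
      w ^ g                                  ≈⟨ ^-congʳ g p ⟩
      z ^ y ^ g                              ≈⟨ ^-^ z y g ⟩
      z ^ (y ∙ g)                            ≈⟨ ^-congˡ z (∙-congʳ q) ⟩
      z ^ (a ∙ g ∙ b ∙ g)                    ≈⟨ ^-congˡ z (solve 3 (λ a g b → a ⊕ g ⊕ b ⊕ g
                                                  ⊜ a ⊕ g ⊕ (b ⊕ ⊖ a) ⊕ (a ⊕ g)) refl a g b) ⟩
      z ^ (a ∙ g ∙ (b ∙ a ⁻¹) ∙ (a ∙ g))     ≈⟨ ^-yhy (Y-∙ˡ a∈K g∈Y) (K-∙ b∈K (K-⁻¹ a∈K)) ⟩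
      z ^ ((b ∙ a ⁻¹) ⁻¹)                    ∎)

    -- g⁻¹ = g⁻² g, and g⁻² fixes every z^h with h in K.
    orbit-g⁻¹ : ∀ {w} → Orbit w → Orbit (w ^ (g ⁻¹))
    orbit-g⁻¹ {w} (byK {h} h∈K p) = byY (Y-∙ˡ h∈K g∈Y) (begin
      w ^ (g ⁻¹)                  ≈⟨ ^-congʳ (g ⁻¹) p ⟩
      z ^ h ^ (g ⁻¹)              ≈⟨ ^-congˡ (z ^ h) (solve 1 (λ g → ⊖ g ⊜ ⊖ (g ⊕ g) ⊕ g) refl g) ⟩
      z ^ h ^ ((g ∙ g) ⁻¹ ∙ g)    ≈⟨ ^-^ (z ^ h) ((g ∙ g) ⁻¹) g ⟨
      z ^ h ^ ((g ∙ g) ⁻¹) ^ g    ≈⟨ ^-congʳ g (comm⇒^ (C-⁻¹ (C-y² g∈Y) h∈K)) ⟩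
      z ^ h ^ g                   ≈⟨ ^-^ z h g ⟩
      z ^ (h ∙ g)                 ∎)
    -- With y₁ = ag one has agbg⁻¹ = (y₁by₁) y₁⁻² a. The first factor takes z to z^(b⁻¹), which y₁⁻²
    -- fixes.
    orbit-g⁻¹ {w} (byY {y} (a , b , a∈K , b∈K , q) p) = byK (K-∙ (K-⁻¹ b∈K) a∈K) (begin
      w ^ (g ⁻¹)                               ≈⟨ ^-congʳ (g ⁻¹) p ⟩
      z ^ y ^ (g ⁻¹)                           ≈⟨ ^-^ z y (g ⁻¹) ⟩
      z ^ (y ∙ g ⁻¹)                           ≈⟨ ^-congˡ z (∙-congʳ q) ⟩
      z ^ (a ∙ g ∙ b ∙ g ⁻¹)
        ≈⟨ ^-congˡ z (solve 3 (λ a g b → a ⊕ g ⊕ b ⊕ ⊖ g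
             ⊜ a ⊕ g ⊕ b ⊕ (a ⊕ g) ⊕ (⊖ ((a ⊕ g) ⊕ (a ⊕ g)) ⊕ a)) refl a g b) ⟩
      z ^ (y₁ ∙ b ∙ y₁ ∙ ((y₁ ∙ y₁) ⁻¹ ∙ a))   ≈⟨ ^-^ z (y₁ ∙ b ∙ y₁) ((y₁ ∙ y₁) ⁻¹ ∙ a) ⟨
      z ^ (y₁ ∙ b ∙ y₁) ^ ((y₁ ∙ y₁) ⁻¹ ∙ a)   ≈⟨ ^-congʳ _ (^-yhy y₁∈Y b∈K) ⟩
      z ^ (b ⁻¹) ^ ((y₁ ∙ y₁) ⁻¹ ∙ a)          ≈⟨ ^-^ (z ^ (b ⁻¹)) ((y₁ ∙ y₁) ⁻¹) a ⟨
      z ^ (b ⁻¹) ^ ((y₁ ∙ y₁) ⁻¹) ^ a          ≈⟨ ^-congʳ a (comm⇒^ (C-⁻¹ (C-y² y₁∈Y) (K-⁻¹ b∈K))) ⟩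
      z ^ (b ⁻¹) ^ a                           ≈⟨ ^-^ z (b ⁻¹) a ⟩
      z ^ (b ⁻¹ ∙ a)                           ∎)
      where
      y₁ : Carrier
      y₁ = a ∙ g
      y₁∈Y : Y y₁
      y₁∈Y = Y-∙ˡ a∈K g∈Y

    orbit-commutes : ∀ {w} → Orbit w → Comm z w
    orbit-commutes (byK h∈K p) = comm-resp refl (sym p) (sym (C-z h∈K))
    orbit-commutes (byY y∈Y p) = comm-resp refl (sym p) (comm-z-zʸ y∈Y)

open ≡ using (refl; sym; trans; cong; cong₂; subst)

-- Decidability of generated subgroups

module _ {n} {P : Fin n → Set} (P? : Decidable P) where

  subsetOf : Subset n
  subsetOf = Vec.tabulate (λ x → does (P? x))

  ∈-subsetOf⁺ : ∀ {x} → P x → x ∈ subsetOf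
  ∈-subsetOf⁺ {x} p = lookup⇒[]= x _ (trans (lookup∘tabulate _ x) (dec-true (P? x) p))

  ∈-subsetOf⁻ : ∀ {x} → x ∈ subsetOf → P x
  ∈-subsetOf⁻ {x} x∈ with P? x | trans (sym (lookup∘tabulate _ x)) ([]=⇒lookup x∈)
  ... | yes p | _ = p
  ... | no  _ | ()

-- A strictly increasing chain of subsets of a finite set stops, and it can only stop where `grow`
-- yields `Q`. Both generated subgroups and the solvable radical are obtained this way.
saturate : ∀ {n ℓ q} (P : Subset n → Set ℓ) {Q : Set q} →
           (∀ T → P T → (∃[ T′ ] T ⊂ T′ × P T′) ⊎ Q) → ∀ T → P T → Q
saturate P {Q} grow T = go T (⊃-wellFounded T)
  where
  go : ∀ T → Acc _ T → P T → Q
  go T (acc rs) p with grow T p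
  ... | inj₁ (T′ , T⊂T′ , p′) = go T′ (rs T⊂T′) p′
  ... | inj₂ q = q

module _ (G : FinGroup) where
  open FinGroup G

  group : Group 0ℓ 0ℓ
  group = record { isGroup = isGroup }

  gen-bind : ∀ {S T} → (∀ {g} → S g → Gen G T g) → ∀ {g} → Gen G S g → Gen G T g
  gen-bind f (gen-base s)  = f s
  gen-bind f gen-ε         = gen-ε
  gen-bind f (gen-mul p q) = gen-mul (gen-bind f p) (gen-bind f q)
  gen-bind f (gen-inv p)   = gen-inv (gen-bind f p)

  generates-bind : ∀ {S T} → (∀ {g} → S g → Gen G T g) → Generates G S → Generates G T
  generates-bind f S-gen g = gen-bind f (S-gen g)

  module _ {S : Fin n → Set} (S? : Decidable S) where

    Derivable : Subset n → Fin n → Set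
    Derivable T g = S g ⊎ g ≡ ε ⊎ (∃[ x ] ∃[ y ] x ∈ T × y ∈ T × g ≡ x ∙ y)
                    ⊎ (∃[ x ] x ∈ T × g ≡ x ⁻¹)

    derivable? : ∀ T → Decidable (Derivable T)
    derivable? T g = S? g ⊎-dec (g Fin.≟ ε) ⊎-dec
      any? (λ x → any? (λ y → (x ∈? T) ×-dec (y ∈? T) ×-dec (g Fin.≟ x ∙ y))) ⊎-dec
      any? (λ x → (x ∈? T) ×-dec (g Fin.≟ x ⁻¹))

    -- Elements known to be generated are collected one by one. Once no derivable element is
    -- missing, the collection is closed under the group operations and hence is the whole generated
    -- subgroup.
    gen? : Decidable (Gen G S)
    gen? = saturate (λ T → ∀ {g} → g ∈ T → Gen G S g) grow ∅ (⊥-elim ∘ ∉⊥)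
      where
      grow : ∀ T → (∀ {g} → g ∈ T → Gen G S g) →
             (∃[ T′ ] T ⊂ T′ × (∀ {g} → g ∈ T′ → Gen G S g)) ⊎ Decidable (Gen G S)
      grow T sound with any? (λ g → ¬? (g ∈? T) ×-dec derivable? T g)
      ... | yes (g , g∉T , d) =
        inj₁ (T ∪ ⁅ g ⁆ ,
              (p⊆p∪q ⁅ g ⁆ , g , x∈p∪q⁺ (inj₂ (x∈⁅x⁆ g)) , g∉T) ,
              ([ sound , (λ h → subst (Gen G S) (sym (x∈⁅y⁆⇒x≡y g h)) (new d)) ] ∘ x∈p∪q⁻ T ⁅ g ⁆))
        where
        new : ∀ {h} → Derivable T h → Gen G S h
        new (inj₁ s) = gen-base s
        new (inj₂ (inj₁ refl)) = gen-ε
        new (inj₂ (inj₂ (inj₁ (x , y , x∈T , y∈T , refl)))) = gen-mul (sound x∈T) (sound y∈T)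
        new (inj₂ (inj₂ (inj₂ (x , x∈T , refl)))) = gen-inv (sound x∈T)
      ... | no closed = inj₂ (λ g → map′ sound complete (g ∈? T))
        where
        close : ∀ {g} → Derivable T g → g ∈ T
        close {g} d = decidable-stable (g ∈? T) (λ g∉T → closed (g , g∉T , d))
        complete : ∀ {g} → Gen G S g → g ∈ T
        complete (gen-base s)  = close (inj₁ s)
        complete gen-ε         = close (inj₂ (inj₁ refl))
        complete (gen-mul p q) = close (inj₂ (inj₂ (inj₁ (_ , _ , complete p , complete q , refl))))
        complete (gen-inv p)   = close (inj₂ (inj₂ (inj₂ (_ , complete p , refl))))

  -- The solvable radical

  -- Solvability by a chain growing from the trivial subgroup, each layer having its commutators in
  -- the one below. This fits the radical, which is built upwards, whereas `derived` descends from
  -- `G`.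
  data SolvableSubgroup (P : Fin n → Set) : Set₁ where
    trivial : (∀ {g} → P g → g ≡ ε) → SolvableSubgroup P
    extension : ∀ {N} → SolvableSubgroup N → (∀ {g} → Gen G N g → N g) →
                (∀ {x y} → P x → P y → N (comm G x y)) → SolvableSubgroup P

  -- Each layer that is peeled off absorbs one more term of the derived series, so `k` rises by one
  -- per `extension`.
  solvable-from : ∀ {P} → SolvableSubgroup P → ∀ k → (∀ {g} → derived G k g → P g) → Solvable G
  solvable-from (trivial P⇒ε) k ⊆P = k , λ g d → P⇒ε (⊆P d)
  solvable-from (extension {N} N-sol N-closed P′⊆N) k ⊆P = solvable-from N-sol (suc k)
    λ d → N-closed (gen-bind (λ { (x , y , x∈ , y∈ , refl) → gen-base (P′⊆N (⊆P x∈) (⊆P y∈)) }) d)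

  record IsNormalSubgroup (R : Fin n → Set) : Set where
    field
      R-ε    : R ε
      R-∙    : ∀ {x y} → R x → R y → R (x ∙ y)
      R-⁻¹   : ∀ {x} → R x → R (x ⁻¹)
      R-conj : ∀ g {x} → R x → R (g ∙ x ∙ g ⁻¹)

    R-closed : ∀ {g} → Gen G R g → R g
    R-closed (gen-base r)  = r
    R-closed gen-ε         = R-ε
    R-closed (gen-mul p q) = R-∙ (R-closed p) (R-closed q)
    R-closed (gen-inv p)   = R-⁻¹ (R-closed p)

  module Quotient {R : Fin n → Set} (R-normal : IsNormalSubgroup R) where
    open IsNormalSubgroup R-normal
    open GroupSolver group

    _≈_ : Fin n → Fin n → Set
    x ≈ y = R (x ∙ y ⁻¹)

    reflexive : ∀ {x y} → x ≡ y → x ≈ y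
    reflexive {x} refl = subst R (sym (Group.inverseʳ group x)) R-ε

    -- G/R keeps the carrier and the operations of `G` and changes only the equality, so words mean
    -- the same in both groups and identities of `G` carry over by `reflexive`.
    quotient : Group 0ℓ 0ℓ
    quotient = record
      { _≈_ = _≈_ ; _∙_ = _∙_ ; ε = ε ; _⁻¹ = _⁻¹
      ; isGroup = record
        { isMonoid = record
          { isSemigroup = record
            { isMagma = record
              { isEquivalence = record
                { refl  = reflexive refl
                ; sym   = λ {x} {y} p → subst R
                    (solve 2 (λ x y → ⊖ (x ⊕ ⊖ y) ⊜ y ⊕ ⊖ x) refl x y) (R-⁻¹ p)
                ; trans = λ {x} {y} {z} p q → subst R
                    (solve 3 (λ x y z → (x ⊕ ⊖ y) ⊕ (y ⊕ ⊖ z) ⊜ x ⊕ ⊖ z) refl x y z) (R-∙ p q)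
                }
              ; ∙-cong = λ {x} {y} {u} {v} p q → subst R
                  (solve 4 (λ x y u v → (x ⊕ (u ⊕ ⊖ v) ⊕ ⊖ x) ⊕ (x ⊕ ⊖ y) ⊜ (x ⊕ u) ⊕ ⊖ (y ⊕ v))
                    refl x y u v)
                  (R-∙ (R-conj x q) p)
              }
            ; assoc = λ x y z → reflexive (Group.assoc group x y z)
            }
          ; identity = (λ x → reflexive (Group.identityˡ group x)) ,
                       (λ x → reflexive (Group.identityʳ group x))
          }
        ; inverse = (λ x → reflexive (Group.inverseˡ group x)) ,
                    (λ x → reflexive (Group.inverseʳ group x))
        ; ⁻¹-cong = λ {x} {y} p → subst R
            (solve 2 (λ x y → ⊖ x ⊕ ⊖ (x ⊕ ⊖ y) ⊕ ⊖ ⊖ x ⊜ ⊖ x ⊕ ⊖ ⊖ y) refl x y)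
            (R-conj (x ⁻¹) (R-⁻¹ p))
        }
      }

    open Commutation quotient public

    R⇒≈ε : ∀ {x} → R x → x ≈ ε
    R⇒≈ε {x} = subst R (solve 1 (λ x → x ⊜ x ⊕ ⊖ id) refl x)

    R⇒comm : ∀ {x} y → R x → Comm y x
    R⇒comm y r = comm-resp (reflexive refl) (Group.sym quotient (R⇒≈ε r)) (comm-ε y)

    gen-comm : ∀ {S z} → (∀ {s} → S s → Comm z s) → ∀ {g} → Gen G S g → Comm z g
    gen-comm f (gen-base s)  = f s
    gen-comm f gen-ε         = comm-ε _
    gen-comm f (gen-mul p q) = comm-∙ (gen-comm f p) (gen-comm f q)
    gen-comm f (gen-inv p)   = comm-⁻¹ (gen-comm f p)

    comm? : Decidable R → ∀ x y → Dec (Comm x y)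
    comm? R? x y = R? _

  record SolvableNormal (R : Subset n) : Set₁ where
    field
      normal   : IsNormalSubgroup (_∈ R)
      solvable : SolvableSubgroup (_∈ R)

    open Quotient normal public

  conj-closed : ∀ {S} → (∀ g {x} → S x → S (g ∙ x ∙ g ⁻¹)) →
                ∀ g {x} → Gen G S x → Gen G S (g ∙ x ∙ g ⁻¹)
  conj-closed S-conj g (gen-base s) = gen-base (S-conj g s)
  conj-closed {S} S-conj g gen-ε = subst (Gen G S) (solve 1 (λ g → id ⊜ g ⊕ id ⊕ ⊖ g) refl g) gen-ε
    where open GroupSolver group
  conj-closed {S} S-conj g (gen-mul {x} {y} p q) = subst (Gen G S)
    (solve 3 (λ g x y → (g ⊕ x ⊕ ⊖ g) ⊕ (g ⊕ y ⊕ ⊖ g) ⊜ g ⊕ (x ⊕ y) ⊕ ⊖ g) refl g x y)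
    (gen-mul (conj-closed S-conj g p) (conj-closed S-conj g q))
    where open GroupSolver group
  conj-closed {S} S-conj g (gen-inv {x} p) = subst (Gen G S)
    (solve 2 (λ g x → ⊖ (g ⊕ x ⊕ ⊖ g) ⊜ g ⊕ ⊖ x ⊕ ⊖ g) refl g x)
    (gen-inv (conj-closed S-conj g p))
    where open GroupSolver group

  -- G/R has no non-trivial abelian normal subgroup.
  Saturated : ∀ {R} → SolvableNormal R → Set
  Saturated {R} rad = ∀ {z} → (∀ q → Comm z (z ^ q)) → z ∈ R
    where open SolvableNormal rad

  -- If some z outside R commutes modulo R with all its conjugates, then R and these conjugates
  -- generate a larger normal subgroup that is abelian over R, hence still solvable. Enlarging stops
  -- at a saturated R.
  radical : ∃[ R ] ∃[ rad ] Saturated {R} rad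
  radical = saturate SolvableNormal grow ⁅ ε ⁆ record
    { normal = record
      { R-ε    = x∈⁅x⁆ ε
      ; R-∙    = λ p q → is-ε (trans (cong₂ _∙_ (eq p) (eq q)) (identityˡ ε))
      ; R-⁻¹   = λ p → is-ε (trans (cong _⁻¹ (eq p)) ε⁻¹≈ε)
      ; R-conj = λ g p → is-ε (trans (cong (λ x → g ∙ x ∙ g ⁻¹) (eq p))
                   (solve 1 (λ g → g ⊕ id ⊕ ⊖ g ⊜ id) refl g))
      }
    ; solvable = trivial eq
    }
    where
    open GroupSolver group
    open Group group using (identityˡ)
    open import Algebra.Properties.Group group using (ε⁻¹≈ε)

    eq : ∀ {x} → x ∈ ⁅ ε ⁆ → x ≡ ε
    eq = x∈⁅y⁆⇒x≡y ε

    is-ε : ∀ {x} → x ≡ ε → x ∈ ⁅ ε ⁆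
    is-ε refl = x∈⁅x⁆ ε

    grow : ∀ R → SolvableNormal R →
           (∃[ R′ ] R ⊂ R′ × SolvableNormal R′) ⊎ (∃[ R ] ∃[ rad ] Saturated {R} rad)
    grow R rad = result
      where
      open SolvableNormal rad
      open IsNormalSubgroup normal

      enlarge : ∀ z → z ∉ R → (∀ q → Comm z (z ^ q)) → ∃[ R′ ] R ⊂ R′ × SolvableNormal R′
      enlarge z z∉R z-comm = R′ ,
        ((λ x∈R → ∈-subsetOf⁺ S? (gen-base (inj₁ x∈R))) ,
         z , ∈-subsetOf⁺ S? (gen-base (inj₂ (ε , solve 1 (λ z → z ⊜ ⊖ id ⊕ z ⊕ id) refl z))) , z∉R) ,
        record
          { normal = record
            { R-ε    = ∈-subsetOf⁺ S? gen-ε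
            ; R-∙    = λ p q → ∈-subsetOf⁺ S? (gen-mul (∈-subsetOf⁻ S? p) (∈-subsetOf⁻ S? q))
            ; R-⁻¹   = λ p → ∈-subsetOf⁺ S? (gen-inv (∈-subsetOf⁻ S? p))
            ; R-conj = λ g p → ∈-subsetOf⁺ S? (conj-closed S-conj g (∈-subsetOf⁻ S? p))
            }
          -- Generators of R′ commute modulo R; `gen-comm`, applied once in each argument, extends
          -- this to all of R′.
          ; solvable = extension solvable R-closed λ {x} {y} p q →
              commutator x y (gen-comm (λ s → Group.sym quotient
                (gen-comm (S-comm s) (∈-subsetOf⁻ S? p))) (∈-subsetOf⁻ S? q))
          }
        where
        S : Fin n → Set
        S x = x ∈ R ⊎ (∃[ q ] x ≡ z ^ q)

        S? : Decidable (Gen G S)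
        S? = gen? (λ x → (x ∈? R) ⊎-dec any? (λ q → x Fin.≟ z ^ q))

        R′ : Subset n
        R′ = subsetOf S?

        S-conj : ∀ g {x} → S x → S (g ∙ x ∙ g ⁻¹)
        S-conj g (inj₁ x∈R) = inj₁ (R-conj g x∈R)
        S-conj g (inj₂ (q , refl)) = inj₂ (q ∙ g ⁻¹ ,
          solve 3 (λ g q z → g ⊕ (⊖ q ⊕ z ⊕ q) ⊕ ⊖ g ⊜ ⊖ (q ⊕ ⊖ g) ⊕ z ⊕ (q ⊕ ⊖ g)) refl g q z)

        S-comm : ∀ {s t} → S s → S t → Comm s t
        S-comm {s} _ (inj₁ t∈R) = R⇒comm s t∈R
        S-comm {t = t} (inj₁ s∈R) _ = Group.sym quotient (R⇒comm t s∈R)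
        S-comm (inj₂ (q , refl)) (inj₂ (r , refl)) = subst (Comm (z ^ q))
          (solve 3 (λ q r z → ⊖ q ⊕ (⊖ (r ⊕ ⊖ q) ⊕ z ⊕ (r ⊕ ⊖ q)) ⊕ q ⊜ ⊖ r ⊕ z ⊕ r) refl q r z)
          (comm-^ q (z-comm (r ∙ q ⁻¹)))

        commutator : ∀ x y → Comm x y → comm G x y ∈ R
        -- `Comm x y` unfolds to xy(yx)⁻¹ ∈ R, and conjugation by (yx)⁻¹ turns this element into
        -- (yx)⁻¹xy, the commutator.
        commutator x y p = subst (_∈ R)
          (solve 2 (λ x y → ⊖ (y ⊕ x) ⊕ ((x ⊕ y) ⊕ ⊖ (y ⊕ x)) ⊕ ⊖ ⊖ (y ⊕ x)
             ⊜ ⊖ x ⊕ ⊖ y ⊕ x ⊕ y) refl x y)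
          (R-conj ((y ∙ x) ⁻¹) p)

      result : (∃[ R′ ] R ⊂ R′ × SolvableNormal R′) ⊎ (∃[ R ] ∃[ rad ] Saturated {R} rad)
      result with any? (λ z → ¬? (z ∈? R) ×-dec all? (λ q → comm? (_∈? R) z (z ^ q)))
      ... | yes (z , z∉R , z-comm) = inj₁ (enlarge z z∉R z-comm)
      ... | no max = inj₂ (R , rad , λ {z} z-comm →
              decidable-stable (z ∈? R) (λ z∉R → max (z , z∉R , z-comm)))

-- Linked generating sequences

module _ (G : FinGroup) where
  open FinGroup G

  Others : ∀ {d} → (Fin d → Fin n) → Fin d → Fin n → Set
  Others a k g = ∃[ i ] i ≢ k × a i ≡ g

  -- An index is deleted and not a value, so a repeated entry counts as redundant and an independent
  -- generating sequence is injective.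
  Independent : ∀ {d} → (Fin d → Fin n) → Set
  Independent a = ∀ k → ¬ Generates G (Others a k)

  -- The first condition is stated in `G` itself, where the digraph lives; the construction provides
  -- the stronger version modulo R. The second one makes the order of `y ∙ x ⁻¹` exceed 2.
  Link : Fin n → Fin n → Set
  Link x y = (x ∙ x) ∙ (y ∙ y) ≢ (y ∙ y) ∙ (x ∙ x) × (y ∙ x ⁻¹) ∙ (y ∙ x ⁻¹) ≢ ε

  record LinkedBasis {d} (a : Fin d → Fin n) : Set where
    field
      generates   : Generates G (Range G a)
      independent : Independent a
      square≢ε    : ∀ i → a i ∙ a i ≢ ε
      linked      : ∀ i j → toℕ j ≡ suc (toℕ i) → Link (a i) (a j)

-- Replacing generators one at a time modulo the radical

module _ (G : FinGroup) {R : Subset (FinGroup.n G)} (rad : SolvableNormal G R)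
         (saturated : Saturated G rad) (R-proper : ¬ (∀ g → g ∈ R)) where
  open FinGroup G
  open SolvableNormal rad
  open IsNormalSubgroup normal
  open Group quotient using () renaming (refl to ≈-refl; sym to ≈-sym)

  Span : List (Fin n) → Fin n → Set
  Span xs = Gen G (_∈ˡ xs)

  span? : ∀ xs → Decidable (Span xs)
  span? xs = gen? G (λ g → DecList._∈?_ Fin._≟_ g xs)

  -- With K the span of `gs`, any element of KgK may replace g. If z commuted modulo R with all
  -- squares from KgK, its class modulo R would be `Orbit`, whose members commute with z, and
  -- saturation would put z into R.
  noncommuting-square : ∀ gs g z → Generates G (_∈ˡ g ∷ gs) → Span gs z → z ∉ R →
                        ∃[ y ] Generates G (_∈ˡ y ∷ gs) × ¬ Comm z (y ∙ y)
  noncommuting-square gs g z gen z∈K z∉R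
    with any? (λ h → any? (λ h′ → span? gs h ×-dec span? gs h′ ×-dec
           ¬? (comm? (_∈? R) z ((h ∙ g ∙ h′) ∙ (h ∙ g ∙ h′)))))
  ... | yes (h , h′ , h∈K , h′∈K , ¬comm) = h ∙ g ∙ h′ , generates-bind G replace gen , ¬comm
    where
    open GroupSolver (group G)
    weaken : ∀ {x} → Span gs x → Span (h ∙ g ∙ h′ ∷ gs) x
    weaken = gen-bind G (gen-base ∘ there)
    replace : ∀ {x} → x ∈ˡ g ∷ gs → Span (h ∙ g ∙ h′ ∷ gs) x
    replace (here refl) = subst (Span _)
      (solve 3 (λ h g h′ → ⊖ h ⊕ (h ⊕ g ⊕ h′) ⊕ ⊖ h′ ⊜ g) refl h g h′)
      (gen-mul (gen-mul (gen-inv (weaken h∈K)) (gen-base (here refl))) (gen-inv (weaken h′∈K)))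
    replace (there x∈gs) = gen-base (there x∈gs)
  ... | no none = contradiction
    (saturated (λ q → orbit-commutes (proj₁ (orbit-conj (gen q) orbit-z)))) z∉R
    where
    commuting : ∀ {h h′} → Span gs h → Span gs h′ → Comm z ((h ∙ g ∙ h′) ∙ (h ∙ g ∙ h′))
    commuting {h} {h′} h∈K h′∈K = decidable-stable (comm? (_∈? R) _ _)
      λ ¬comm → none (h , h′ , h∈K , h′∈K , ¬comm)
    open DoubleCoset.CommutingSquares quotient (Span gs) gen-ε gen-mul gen-inv g z z∈K commuting
    open GroupSolver (group G)
    -- Conjugation by q and by q⁻¹ is treated at once, as the case `gen-inv` exchanges the two.
    orbit-conj : ∀ {q w} → Span (g ∷ gs) q → Orbit w → Orbit (w ^ q) × Orbit (w ^ (q ⁻¹))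
    orbit-conj (gen-base (here refl)) o = orbit-g o , orbit-g⁻¹ o
    orbit-conj (gen-base (there q∈gs)) o =
      orbit-K (gen-base q∈gs) o , orbit-K (gen-inv (gen-base q∈gs)) o
    orbit-conj gen-ε o = orbit-K gen-ε o , orbit-K (gen-inv gen-ε) o
    orbit-conj {w = w} (gen-mul {q} {r} q∈ r∈) o =
      orbit-resp (^-^ w q r) (proj₁ (orbit-conj r∈ (proj₁ (orbit-conj q∈ o)))) ,
      subst Orbit
        (solve 3 (λ q r w → ⊖ ⊖ q ⊕ (⊖ ⊖ r ⊕ w ⊕ ⊖ r) ⊕ ⊖ q ⊜ ⊖ ⊖ (q ⊕ r) ⊕ w ⊕ ⊖ (q ⊕ r))
          refl q r w)
        (proj₂ (orbit-conj q∈ (proj₂ (orbit-conj r∈ o))))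
    orbit-conj {w = w} (gen-inv {q} q∈) o = proj₂ (orbit-conj q∈ o) ,
      subst Orbit (solve 2 (λ q w → ⊖ q ⊕ w ⊕ q ⊜ ⊖ ⊖ ⊖ q ⊕ w ⊕ ⊖ ⊖ q) refl q w)
        (proj₁ (orbit-conj q∈ o))

  LinkedOutsideR : List (Fin n) → Set
  LinkedOutsideR xs = Linked (Link G) xs × All (λ x → x ∙ x ∉ R) xs

  noncommuting⇒∉R : ∀ {z w} → ¬ Comm z w → w ∉ R
  noncommuting⇒∉R ¬comm w∈R = ¬comm (R⇒comm _ w∈R)

  -- If both y and y⁻¹ violated the second condition on a link, then x² and y² would commute.
  link-up : ∀ gs g x → Generates G (_∈ˡ g ∷ gs) → x ∈ˡ gs → x ∙ x ∉ R →
            ∃[ y ] Generates G (_∈ˡ y ∷ gs) × Link G y x × y ∙ y ∉ R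
  link-up gs g x gen x∈gs x²∉R
    with noncommuting-square gs g (x ∙ x) gen (gen-mul (gen-base x∈gs) (gen-base x∈gs)) x²∉R
  ... | y , y-gen , ¬comm with (x ∙ y ⁻¹) ∙ (x ∙ y ⁻¹) Fin.≟ ε
  ... | no  ≢ε = y , y-gen , ((λ eq → ¬comm (reflexive (sym eq))) , ≢ε) , noncommuting⇒∉R ¬comm
  ... | yes ≡ε = y ⁻¹ , generates-bind G invert y-gen ,
      ((λ eq → ¬comm′ (reflexive (sym eq))) , ≢ε) , noncommuting⇒∉R ¬comm′
    where
    open GroupSolver (group G)
    open Commutation (group G) using () renaming (squares-commute to squares-commute′)
    y⁻²⁻¹ : (y ⁻¹ ∙ y ⁻¹) ⁻¹ ≡ y ∙ y
    y⁻²⁻¹ = solve 1 (λ y → ⊖ (⊖ y ⊕ ⊖ y) ⊜ y ⊕ y) refl y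
    ¬comm′ : ¬ Comm (x ∙ x) (y ⁻¹ ∙ y ⁻¹)
    ¬comm′ p = ¬comm (subst (Comm (x ∙ x)) y⁻²⁻¹ (comm-⁻¹ p))
    ≢ε : (x ∙ y ⁻¹ ⁻¹) ∙ (x ∙ y ⁻¹ ⁻¹) ≢ ε
    ≢ε p = ¬comm (reflexive (squares-commute′
      (trans (solve 2 (λ x y → (x ⊕ y) ⊕ (x ⊕ y) ⊜ (x ⊕ ⊖ ⊖ y) ⊕ (x ⊕ ⊖ ⊖ y)) refl x y) p) ≡ε))
    invert : ∀ {h} → h ∈ˡ y ∷ gs → Span (y ⁻¹ ∷ gs) h
    invert (here refl) = subst (Span _) (solve 1 (λ y → ⊖ ⊖ y ⊜ y) refl y)
      (gen-inv (gen-base (here refl)))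
    invert (there h∈gs) = gen-base (there h∈gs)

  -- If every generator but g lies in R, then g is central modulo R, hence g lies in R too.
  first-generator : ∀ gs g → Generates G (_∈ˡ g ∷ gs) →
                    ∃[ y ] Generates G (_∈ˡ y ∷ gs) × y ∙ y ∉ R
  first-generator gs g gen with anyList? (λ z → ¬? (z ∈? R)) gs
  ... | yes z∉R =
    let z , z∈gs , z∉R = find z∉R
        y , y-gen , ¬comm = noncommuting-square gs g z gen (gen-base z∈gs) z∉R
    in y , y-gen , noncommuting⇒∉R ¬comm
  ... | no none = contradiction (λ h → R-closed (gen-bind G all∈R (gen h))) R-proper
    where
    gs⊆R : ∀ {z} → z ∈ˡ gs → z ∈ R
    gs⊆R {z} z∈gs = decidable-stable (z ∈? R) λ z∉R → none (lose z∈gs z∉R)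
    central : ∀ q → Comm g q
    central q = gen-comm (λ { (here refl) → ≈-refl ; (there s∈gs) → R⇒comm g (gs⊆R s∈gs) }) (gen q)
    all∈R : ∀ {h} → h ∈ˡ g ∷ gs → Gen G (_∈ R) h
    all∈R (here refl) = gen-base (saturated λ q → comm-resp ≈-refl (≈-sym (comm⇒^ (central q))) ≈-refl)
    all∈R (there h∈gs) = gen-base (gs⊆R h∈gs)

  rotate : ∀ {x} gs xs → Generates G (_∈ˡ x ∷ gs ++ xs) → Generates G (_∈ˡ gs ++ x ∷ xs)
  rotate gs xs = generates-bind G (gen-base ∘ ∈-resp-↭ (↭-sym (shift _ gs xs)))

  -- `gs` is still to be treated and `x ∷ xs` is the finished chain, which grows at its front. The
  -- span of both without g contains x, which is what `link-up` requires. The length is recorded for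
  -- the later descent.
  link-all : ∀ gs x xs → Generates G (_∈ˡ gs ++ x ∷ xs) → LinkedOutsideR (x ∷ xs) →
             ∃[ ys ] Generates G (_∈ˡ ys) × LinkedOutsideR ys ×
                     length ys ≡ length gs + suc (length xs)
  link-all [] x xs gen links = x ∷ xs , gen , links , refl
  link-all (g ∷ gs) x xs gen (links , x²∉R ∷ all∉R)
    with y , y-gen , y-x , y²∉R ← link-up (gs ++ x ∷ xs) g x gen
           (∈-resp-↭ (↭-sym (shift x gs xs)) (here refl)) x²∉R
    with ys , ys-gen , ys-links , eq ← link-all gs y (x ∷ xs) (rotate gs (x ∷ xs) y-gen)
           (y-x ∷ links , y²∉R ∷ x²∉R ∷ all∉R)
    = ys , ys-gen , ys-links , trans eq (ℕ.+-suc (length gs) _)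

  linked-generators : ∀ gs → Generates G (_∈ˡ gs) →
    ∃[ ys ] Generates G (_∈ˡ ys) × LinkedOutsideR ys × length ys ≡ length gs
  linked-generators [] gen = contradiction (λ h → R-closed (gen-bind G (λ ()) (gen h))) R-proper
  linked-generators (g ∷ gs) gen
    with y , y-gen , y²∉R ← first-generator gs g gen
    with ys , ys-gen , links , eq ← link-all gs y []
           (generates-bind G (gen-base ∘ ∈-resp-↭ (∷↭∷ʳ y gs)) y-gen) ([-] , y²∉R ∷ [])
    = ys , ys-gen , links , trans eq (ℕ.+-comm (length gs) 1)

  lookup-linked : ∀ {xs} → Linked (Link G) xs → ∀ (i j : Fin (length xs)) →
                  toℕ j ≡ suc (toℕ i) → Link G (List.lookup xs i) (List.lookup xs j)
  lookup-linked (xy ∷ _)    zero    (suc zero) _ = xy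
  lookup-linked (_ ∷ links) (suc i) (suc j)    p = lookup-linked links i j (ℕ.suc-injective p)
  lookup-linked [-]         zero    zero       ()
  lookup-linked (_ ∷ _)     zero    (suc (suc _)) ()

  -- Dropping a redundant generator may make unlinked entries adjacent, so all links are rebuilt
  -- from scratch. Relinking keeps the length and dropping lowers it, so `d` decreases.
  linked-basis-from : ∀ d gs → length gs ≡ d → Generates G (_∈ˡ gs) →
                      ∃[ d ] ∃[ a ] LinkedBasis G {d} a
  linked-basis-from d gs len gen
    with linked-generators gs gen
  ... | ys , ys-gen , (links , all∉R) , eq
    with any? (λ k → all? (gen? G (λ g →
           any? (λ i → ¬? (i Fin.≟ k) ×-dec (List.lookup ys i Fin.≟ g)))))
  ... | no independent = length ys , List.lookup ys , record
    { generates   = generates-bind G (λ y∈ys → gen-base (index y∈ys , sym (lookup-index y∈ys))) ys-gen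
    ; independent = λ k others-gen → independent (k , others-gen)
    ; square≢ε    = λ i p → All.lookup all∉R (∈-lookup i) (subst (_∈ R) (sym p) R-ε)
    ; linked      = lookup-linked links
    }
  linked-basis-from zero gs len gen | [] , _ | yes (() , _)
  linked-basis-from zero gs len gen | _ ∷ _ , _ , _ , eq | yes _ = contradiction (trans eq len) λ ()
  linked-basis-from (suc d) gs len gen | y ∷ ys , ys-gen , _ , eq | yes (k , others-gen) =
    linked-basis-from d (List.tabulate others)
      (trans (length-tabulate others) (ℕ.suc-injective (trans eq len)))
      (generates-bind G (gen-base ∘ others∈) others-gen)
    where
    others : Fin (length ys) → Fin n
    others i = List.lookup (y ∷ ys) (punchIn k i)
    others∈ : ∀ {g} → Others G (List.lookup (y ∷ ys)) k g → g ∈ˡ List.tabulate others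
    others∈ {g} (i , i≢k , refl) = subst (λ j → List.lookup (y ∷ ys) j ∈ˡ List.tabulate others)
      (punchIn-punchOut (i≢k ∘ sym)) (∈-tabulate⁺ (punchOut (i≢k ∘ sym)))

  linked-basis : ∃[ d ] ∃[ a ] LinkedBasis G {d} a
  linked-basis = linked-basis-from n (List.allFin n) (length-tabulate _) (λ g → gen-base (∈-allFin g))

-- Orders of elements

module _ (G : FinGroup) where
  open FinGroup G
  open Group (group G) using (assoc; identityˡ; identityʳ)
  open import Algebra.Properties.Group (group G) using (∙-cancelˡ)

  pow-+ : ∀ g i j → pow G g (i + j) ≡ pow G g i ∙ pow G g j
  pow-+ g zero    j = sym (identityˡ _)
  pow-+ g (suc i) j = trans (cong (g ∙_) (pow-+ g i j)) (sym (assoc _ _ _))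

  some-period : ∀ g → ∃[ k ] pow G g (suc k) ≡ ε
  some-period g
    with i , j , i<j , eq ← pigeonhole (ℕ.n<1+n n) (pow G g ∘ toℕ)
    with k , i+k≡j ← ℕ.m≤n⇒∃[o]m+o≡n i<j
    = k , ∙-cancelˡ (pow G g (toℕ i)) _ _ (begin
      pow G g (toℕ i) ∙ pow G g (suc k)  ≡⟨ pow-+ g (toℕ i) (suc k) ⟨
      pow G g (toℕ i + suc k)            ≡⟨ cong (pow G g) (trans (ℕ.+-suc (toℕ i) k) i+k≡j) ⟩
      pow G g (toℕ j)                    ≡⟨ eq ⟨
      pow G g (toℕ i)                    ≡⟨ identityʳ _ ⟨
      pow G g (toℕ i) ∙ ε                ∎)
    where open ≡.≡-Reasoning

  -- Upward search for the least period: `k` is the candidate and `r` its distance from a known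
  -- period.
  order-from : ∀ g r k → 1 ≤ k → (∀ m → 1 ≤ m → m < k → pow G g m ≢ ε) → pow G g (k + r) ≡ ε →
               ∃[ o ] HasOrder G g o
  order-from g r k 1≤k below eq with pow G g k Fin.≟ ε
  ... | yes ≡ε = k , 1≤k , ≡ε , below
  order-from g zero    k 1≤k below eq | no ≢ε =
    contradiction (trans (cong (pow G g) (sym (ℕ.+-identityʳ k))) eq) ≢ε
  order-from g (suc r) k 1≤k below eq | no ≢ε =
    order-from g r (suc k) (s≤s z≤n) below′ (trans (cong (pow G g) (sym (ℕ.+-suc k r))) eq)
    where
    below′ : ∀ m → 1 ≤ m → m < suc k → pow G g m ≢ ε
    below′ m 1≤m m<1+k with ℕ.m<1+n⇒m<n∨m≡n m<1+k
    ... | inj₁ m<k  = below m 1≤m m<k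
    ... | inj₂ refl = ≢ε

  square≢ε⇒order>2 : ∀ {g} → g ∙ g ≢ ε → OrderGT2 G g
  square≢ε⇒order>2 {g} g²≢ε
    with k , eq ← some-period g
    with order-from g k 1 (s≤s z≤n) (λ { m (s≤s z≤n) (s≤s ()) }) eq
  ... | 1 , (_ , ≡ε , _) = contradiction
    (trans (cong (λ x → x ∙ x) (trans (sym (identityʳ g)) ≡ε)) (identityˡ ε)) g²≢ε
  ... | 2 , (_ , ≡ε , _) = contradiction (trans (cong (g ∙_) (sym (identityʳ g))) ≡ε) g²≢ε
  ... | suc (suc (suc k)) , o = _ , o , s≤s (s≤s (s≤s z≤n))

-- The connection set {aᵢ} ∪ {aᵢ₊₁aᵢ⁻¹}

-- In an equation between three elements of the connection set, no index occurs in just one of them.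
-- This is the case of one difference, on the indices k and k+1, and two generators.
two-gens-cover : ∀ {k x y : ℕ} → k ≡ x ⊎ k ≡ y → suc k ≡ x ⊎ suc k ≡ y →
                 (x ≡ k × y ≡ suc k) ⊎ (x ≡ suc k × y ≡ k)
two-gens-cover (inj₁ refl) (inj₂ refl) = inj₁ (refl , refl)
two-gens-cover (inj₂ refl) (inj₁ refl) = inj₂ (refl , refl)
two-gens-cover (inj₁ refl) (inj₁ p)    = contradiction p ℕ.1+n≢n
two-gens-cover (inj₂ refl) (inj₂ p)    = contradiction p ℕ.1+n≢n

-- Edge `i` of the path joins `i` and `suc i` and stands for the difference aᵢ₊₁aᵢ⁻¹.
End : ℕ → ℕ → Set
End x i = x ≡ i ⊎ x ≡ suc i

same-edge : ∀ {i j} → End i j → End (suc i) j → i ≡ j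
same-edge (inj₁ p)    _        = p
same-edge (inj₂ refl) (inj₁ p) = contradiction p (ℕ.m+1+n≢n 1)
same-edge (inj₂ refl) (inj₂ p) = contradiction p ℕ.1+n≢n

-- Two distinct edges have at least two ends that are not shared, and the single index `i` can
-- account for only one of them.
two-edges-cover : ∀ {i j k} → End j k ⊎ j ≡ i → End (suc j) k ⊎ suc j ≡ i →
                  End k j ⊎ k ≡ i → End (suc k) j ⊎ suc k ≡ i → j ≡ k
two-edges-cover (inj₁ p)    (inj₁ q)    _ _ = same-edge p q
two-edges-cover _ _ (inj₁ p) (inj₁ q) = sym (same-edge p q)
two-edges-cover (inj₂ refl) (inj₂ q) _ _ = contradiction q ℕ.1+n≢n
two-edges-cover _ _ (inj₂ refl) (inj₂ q) = contradiction q ℕ.1+n≢n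
two-edges-cover (inj₂ refl) _ (inj₂ refl) _ = refl
two-edges-cover _ (inj₂ refl) _ (inj₂ p) = sym (ℕ.suc-injective p)
two-edges-cover (inj₂ refl) (inj₁ (inj₁ p)) (inj₁ _) (inj₂ q) =
  contradiction (trans (cong suc p) q) (ℕ.m+1+n≢n 1)
two-edges-cover (inj₂ refl) (inj₁ (inj₂ p)) (inj₁ _) (inj₂ q) = ℕ.suc-injective p
two-edges-cover (inj₁ _) (inj₂ refl) (inj₂ refl) (inj₁ (inj₁ q)) = contradiction q (ℕ.m+1+n≢n 1)
two-edges-cover (inj₁ _) (inj₂ refl) (inj₂ refl) (inj₁ (inj₂ q)) = contradiction q ℕ.1+n≢n

-- If two edges agree, they cover the third, which is then the same edge. If all differ, the lower
-- end of each is the upper end of another, so none of the three is lowest.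
three-edges-cover : ∀ {i j k} → End i j ⊎ End i k → End (suc i) j ⊎ End (suc i) k →
                    End j i ⊎ End j k → End (suc j) i ⊎ End (suc j) k →
                    End k i ⊎ End k j → End (suc k) i ⊎ End (suc k) j → i ≡ j × j ≡ k
three-edges-cover {i} {j} {k} i₀ i₁ j₀ j₁ k₀ k₁ with i ℕ.≟ j | j ℕ.≟ k | i ℕ.≟ k
... | yes refl | _ | _ = refl , sym (same-edge (Sum.reduce k₀) (Sum.reduce k₁))
... | _ | yes refl | _ = same-edge (Sum.reduce i₀) (Sum.reduce i₁) , refl
... | no i≢j | no _ | yes refl = contradiction (sym (same-edge (Sum.reduce j₀) (Sum.reduce j₁))) i≢j
... | no i≢j | no j≢k | no i≢k =
  ⊥-elim (no-minimum (above i≢j i≢k i₀) (above (i≢j ∘ sym) j≢k j₀) (above (i≢k ∘ sym) (j≢k ∘ sym) k₀))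
  where
  above : ∀ {x y z} → x ≢ y → x ≢ z → End x y ⊎ End x z → y < x ⊎ z < x
  above x≢y x≢z (inj₁ (inj₁ p))    = contradiction p x≢y
  above x≢y x≢z (inj₁ (inj₂ refl)) = inj₁ ℕ.≤-refl
  above x≢y x≢z (inj₂ (inj₁ p))    = contradiction p x≢z
  above x≢y x≢z (inj₂ (inj₂ refl)) = inj₂ ℕ.≤-refl

  no-minimum : j < i ⊎ k < i → i < j ⊎ k < j → i < k ⊎ j < k → ⊥
  no-minimum (inj₁ j<i) (inj₁ i<j) _          = ℕ.<-asym j<i i<j
  no-minimum (inj₁ j<i) (inj₂ k<j) (inj₁ i<k) = ℕ.<-asym (ℕ.<-trans k<j j<i) i<k
  no-minimum (inj₁ j<i) (inj₂ k<j) (inj₂ j<k) = ℕ.<-asym k<j j<k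
  no-minimum (inj₂ k<i) _          (inj₁ i<k) = ℕ.<-asym k<i i<k
  no-minimum (inj₂ k<i) (inj₁ i<j) (inj₂ j<k) = ℕ.<-asym (ℕ.<-trans k<i i<j) j<k
  no-minimum (inj₂ k<i) (inj₂ k<j) (inj₂ j<k) = ℕ.<-asym k<j j<k

-- Consecutive indices have consecutive images, so the map is a translation by the image s₀ of
-- `zero`, and the last index leaves room only for s₀ = 0. The last hypothesis provides an image of
-- `zero` when d = 1 and there is no arc to start from.
no-shift : ∀ {d} (_↦_ : Fin d → Fin d → Set) → (∀ {i k l} → i ↦ k → i ↦ l → k ≡ l) →
           (∀ i j → toℕ j ≡ suc (toℕ i) → ∃[ k ] ∃[ l ] i ↦ k × j ↦ l × toℕ l ≡ suc (toℕ k)) →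
           (∀ i → (∃[ k ] i ↦ k) ⊎ (∃[ i ] ∃[ j ] toℕ {d} j ≡ suc (toℕ {d} i))) →
           ∀ i → i ↦ i
no-shift {suc m} _↦_ functional step some i = unshifted (shifted i)
  where
  start : ∀ {m} (_↦_ : Fin (suc m) → Fin (suc m) → Set) →
          (∀ i j → toℕ j ≡ suc (toℕ i) → ∃[ k ] ∃[ l ] i ↦ k × j ↦ l × toℕ l ≡ suc (toℕ k)) →
          (∀ i → (∃[ k ] i ↦ k) ⊎ (∃[ i ] ∃[ j ] toℕ {suc m} j ≡ suc (toℕ {suc m} i))) →
          ∃[ k ] zero ↦ k
  start {zero} _↦_ step some with some zero
  ... | inj₁ k = k
  ... | inj₂ (zero , zero , ())
  start {suc m} _↦_ step some with k , _ , 0↦k , _ ← step zero (suc zero) refl = k , 0↦k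

  k₀ : Fin (suc m)
  k₀ = proj₁ (start _↦_ step some)

  0↦k₀ : zero ↦ k₀
  0↦k₀ = proj₂ (start _↦_ step some)

  s₀ : ℕ
  s₀ = toℕ k₀

  shifted : ∀ i → ∃[ l ] i ↦ l × toℕ l ≡ s₀ + toℕ i
  shifted = <-weakInduction _ (k₀ , 0↦k₀ , sym (ℕ.+-identityʳ s₀)) next
    where
    next : ∀ i → (∃[ l ] inject₁ i ↦ l × toℕ l ≡ s₀ + toℕ (inject₁ i)) →
           ∃[ l ] suc i ↦ l × toℕ l ≡ s₀ + suc (toℕ i)
    next i (l , i↦l , eq)
      with k , l′ , i↦k , i+1↦l′ , eq′ ← step (inject₁ i) (suc i) (cong suc (sym (toℕ-inject₁ i)))
      with refl ← functional i↦l i↦k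
      = l′ , i+1↦l′ , trans eq′ (trans (cong suc (trans eq (cong (s₀ +_) (toℕ-inject₁ i))))
                                       (sym (ℕ.+-suc s₀ (toℕ i))))

  no-room : s₀ ≡ 0
  no-room with l , _ , eq ← shifted (fromℕ m) =
    ℕ.n≤0⇒n≡0 (ℕ.+-cancelʳ-≤ m s₀ 0
      (subst (_≤ m) (trans eq (cong (s₀ +_) (toℕ-fromℕ m))) (ℕ.s≤s⁻¹ (toℕ<n l))))

  unshifted : ∀ {i} → (∃[ l ] i ↦ l × toℕ l ≡ s₀ + toℕ i) → i ↦ i
  unshifted {i} (l , i↦l , eq) =
    subst (i ↦_) (toℕ-injective (trans eq (cong (_+ toℕ i) no-room))) i↦l

-- Equations among elements of the connection set

module PathConnectionSet (G : FinGroup) {d} (a : Fin d → Fin (FinGroup.n G))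
                         (basis : LinkedBasis G a) where
  open FinGroup G
  open LinkedBasis basis
  open GroupSolver (group G)
  open Commutation (group G)
  open Group (group G) using (assoc; identityˡ; identityʳ; inverseʳ)
  open import Algebra.Properties.Group (group G) using (∙-cancelˡ; ∙-cancelʳ)

  -- The out-neighbours of `ε`, kept as symbols so that the indices occurring in each can be read
  -- off.
  data Vertex : Set where
    gen  : Fin d → Vertex
    diff : ∀ (i j : Fin d) → toℕ j ≡ suc (toℕ i) → Vertex

  val : Vertex → Fin n
  val (gen i)      = a i
  val (diff i j _) = a j ∙ a i ⁻¹

  Touches : ℕ → Vertex → Set
  Touches m (gen i)      = m ≡ toℕ i
  Touches m (diff i _ _) = End m (toℕ i)

  touches? : ∀ m u → Dec (Touches m u)
  touches? m (gen i)      = m ℕ.≟ toℕ i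
  touches? m (diff i _ _) = (m ℕ.≟ toℕ i) ⊎-dec (m ℕ.≟ suc (toℕ i))

  touched-index : ∀ {m} u → Touches m u → ∃[ k ] toℕ {d} k ≡ m
  touched-index (gen i)      refl        = i , refl
  touched-index (diff i j p) (inj₁ refl) = i , refl
  touched-index (diff i j p) (inj₂ refl) = j , p

  Without : Fin d → Fin n → Set
  Without k = Gen G (Others G a k)

  other : ∀ {i k} → toℕ i ≢ toℕ k → Without k (a i)
  other i≢k = gen-base (_ , i≢k ∘ cong toℕ , refl)

  missing : ∀ {k} → ¬ Without k (a k)
  missing {k} k∈ = independent k (generates-bind G range generates)
    where
    range : ∀ {g} → Range G a g → Without k g
    range (i , refl) with i Fin.≟ k
    ... | yes refl = k∈
    ... | no  i≢k  = gen-base (i , i≢k , refl)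

  a-injective : ∀ {i j} → a i ≡ a j → i ≡ j
  a-injective {i} {j} eq = decidable-stable (i Fin.≟ j)
    λ i≢j → missing (subst (Without j) eq (gen-base (i , i≢j , refl)))

  untouched : ∀ {k} u → ¬ Touches (toℕ k) u → Without k (val u)
  untouched (gen i)      k∉ = other (k∉ ∘ sym)
  untouched (diff i j p) k∉ = gen-mul (other λ q → k∉ (inj₂ (trans (sym q) p)))
                                      (gen-inv (other λ q → k∉ (inj₁ (sym q))))

  successor : ∀ {i j k : Fin d} → toℕ j ≡ suc (toℕ i) → toℕ k ≡ suc (toℕ i) → k ≡ j
  successor p q = toℕ-injective (trans q (sym p))

  -- A difference together with either of its two generators yields the other one, so it cannot lie
  -- in a subgroup generated without one of them.
  touched : ∀ {k} u → Touches (toℕ k) u → ¬ Without k (val u)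
  touched (gen i) q with refl ← toℕ-injective q = missing
  touched (diff i j p) (inj₁ q) b∈ = missing (subst (Without i)
    (solve 2 (λ x y → ⊖ (y ⊕ ⊖ x) ⊕ y ⊜ x) refl (a i) (a j))
    (gen-mul (gen-inv (subst (λ k → Without k (a j ∙ a i ⁻¹)) (toℕ-injective q) b∈))
      (other λ j≡i → ℕ.1+n≢n (trans (sym p) j≡i))))
  touched (diff i j p) (inj₂ q) b∈ = missing (subst (Without j)
    (solve 2 (λ x y → (y ⊕ ⊖ x) ⊕ x ⊜ y) refl (a i) (a j))
    (gen-mul (subst (λ k → Without k (a j ∙ a i ⁻¹)) (successor p q) b∈)
      (other λ i≡j → ℕ.1+n≢n (trans (sym p) (sym i≡j)))))

  -- This turns equations into combinatorics: an index of u absent from v and w would place u in the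
  -- subgroup generated without that index, against `touched`.
  shared : ∀ u v w → (∀ {k} → Without k (val v) → Without k (val w) → Without k (val u)) →
           ∀ {m} → Touches m u → Touches m v ⊎ Touches m w
  shared u v w closed {m} m∈u with touches? m v | touches? m w
  ... | yes m∈v | _       = inj₁ m∈v
  ... | no _    | yes m∈w = inj₂ m∈w
  ... | no m∉v  | no m∉w with k , refl ← touched-index u m∈u =
    contradiction (closed (untouched v m∉v) (untouched w m∉w)) (touched u m∈u)

  module _ {i j : Fin d} (p : toℕ j ≡ suc (toℕ i)) where

    -- Commuting pairs, pairs with equal squares and pairs where one inverts the other
    -- are excluded since the squares of linked generators do not commute.
    squares-differ : ¬ Comm (a i ∙ a i) (a j ∙ a j)
    squares-differ = proj₁ (linked i j p)

    not-commuting : ¬ Comm (a i) (a j)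
    not-commuting q = squares-differ (comm-∙ (sq q) (sq q))
      where
      sq : Comm (a i) (a j) → Comm (a i ∙ a i) (a j)
      sq q = sym (comm-∙ (sym q) (sym q))

    diff²≢ε : (a j ∙ a i ⁻¹) ∙ (a j ∙ a i ⁻¹) ≢ ε
    diff²≢ε = proj₂ (linked i j p)

  idempotent⇒square≡ε : ∀ {x} → x ∙ x ≡ x → x ∙ x ≡ ε
  idempotent⇒square≡ε {x} q = trans q (∙-cancelˡ x _ _ (trans q (sym (identityʳ x))))

  fixed⇒square≡ε : ∀ {x y} → x ∙ y ≡ y → x ∙ x ≡ ε
  fixed⇒square≡ε {x} {y} q =
    idempotent⇒square≡ε (∙-cancelʳ y _ _ (trans (assoc _ _ _) (cong (x ∙_) q)))

  fixed⇒square≡ε′ : ∀ {x y} → y ∙ x ≡ y → x ∙ x ≡ ε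
  fixed⇒square≡ε′ {x} {y} q =
    idempotent⇒square≡ε (∙-cancelˡ y _ _ (trans (sym (assoc _ _ _)) (cong (_∙ x) q)))

  IsPathArc : Vertex → Vertex → Set
  IsPathArc v w = ∃[ i ] ∃[ j ] v ≡ gen i × w ≡ gen j × toℕ j ≡ suc (toℕ i)

  -- The arcs between out-neighbours of ε are those of the path a₁ → a₂ → ⋯.
  arcs-in-connection-set : ∀ u v w → val u ∙ val v ≡ val w → IsPathArc v w
  arcs-in-connection-set u v w eq = cases u v w eq in-u in-v in-w
    where
    in-u : ∀ {m} → Touches m u → Touches m v ⊎ Touches m w
    in-u = shared u v w λ v∈ w∈ → subst (Without _)
      (trans (cong (_∙ val v ⁻¹) (sym eq))
        (solve 2 (λ u v → u ⊕ v ⊕ ⊖ v ⊜ u) refl (val u) (val v)))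
      (gen-mul w∈ (gen-inv v∈))
    in-v : ∀ {m} → Touches m v → Touches m u ⊎ Touches m w
    in-v = shared v u w λ u∈ w∈ → subst (Without _)
      (trans (cong (val u ⁻¹ ∙_) (sym eq))
        (solve 2 (λ u v → ⊖ u ⊕ (u ⊕ v) ⊜ v) refl (val u) (val v)))
      (gen-mul (gen-inv u∈) w∈)
    in-w : ∀ {m} → Touches m w → Touches m u ⊎ Touches m v
    in-w = shared w u v λ u∈ v∈ → subst (Without _) eq (gen-mul u∈ v∈)

    cases : ∀ u v w → val u ∙ val v ≡ val w →
            (∀ {m} → Touches m u → Touches m v ⊎ Touches m w) →
            (∀ {m} → Touches m v → Touches m u ⊎ Touches m w) →
            (∀ {m} → Touches m w → Touches m u ⊎ Touches m v) → IsPathArc v w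
    cases (gen i) (gen j) (gen k) eq in-u in-v in-w =
      contradiction a-idem (square≢ε i ∘ idempotent⇒square≡ε)
      where
      a-idem : a i ∙ a i ≡ a i
      a-idem with in-u refl
      ... | inj₁ p with refl ← toℕ-injective p with refl ← toℕ-injective (Sum.reduce (in-w refl)) = eq
      ... | inj₂ p with refl ← toℕ-injective p with refl ← toℕ-injective (Sum.reduce (in-v refl)) = eq
    cases (diff k l p) (gen i) (gen j) eq in-u in-v in-w
      with two-gens-cover (in-u (inj₁ refl)) (in-u (inj₂ refl))
    ... | inj₁ (q , r) = i , j , refl , refl , trans r (cong suc (sym q))
    -- The reversed orientation reads b a_l = a_k with b = a_l a_k⁻¹, that is, b² = 1.
    ... | inj₂ (q , r) with refl ← successor p q | refl ← toℕ-injective r =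
      contradiction (trans (sym (assoc _ _ _)) (trans (cong (_∙ a k ⁻¹) eq) (inverseʳ _))) (diff²≢ε p)
    cases (gen i) (diff k l p) (gen j) eq in-u in-v in-w
      with two-gens-cover (in-v (inj₁ refl)) (in-v (inj₂ refl))
    ... | inj₁ (q , r) with refl ← successor p r | refl ← toℕ-injective q = contradiction
      (trans (solve 2 (λ x y → x ⊕ y ⊜ x ⊕ (y ⊕ ⊖ x) ⊕ x) refl (a k) (a l)) (cong (_∙ a k) eq))
      (not-commuting p)
    ... | inj₂ (q , r) with refl ← successor p q | refl ← toℕ-injective r =
      contradiction (comm-resp equal refl refl) (squares-differ p)
      where
      equal : a l ∙ a l ≡ a k ∙ a k
      equal = trans (solve 2 (λ x y → y ⊕ y ⊜ y ⊕ (y ⊕ ⊖ x) ⊕ x) refl (a k) (a l)) (cong (_∙ a k) eq)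
    cases (gen i) (gen j) (diff k l p) eq in-u in-v in-w
      with two-gens-cover (in-w (inj₁ refl)) (in-w (inj₂ refl))
    -- The equation is xy = yx⁻¹: conjugation by y inverts x, so y² centralizes x.
    ... | inj₁ (q , r) with refl ← successor p r | refl ← toℕ-injective q =
      contradiction (sym (comm-∙ (sym y²x) (sym y²x))) (squares-differ p)
      where
      x y : Fin n
      x = a k
      y = a l
      x⁻¹y : x ⁻¹ ∙ y ≡ y ∙ x
      x⁻¹y = begin
        x ⁻¹ ∙ y                ≡⟨ solve 2 (λ x y → ⊖ x ⊕ y ⊜ ⊖ x ⊕ (y ⊕ ⊖ x) ⊕ x) refl x y ⟩
        x ⁻¹ ∙ (y ∙ x ⁻¹) ∙ x   ≡⟨ cong (λ z → x ⁻¹ ∙ z ∙ x) eq ⟨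
        x ⁻¹ ∙ (x ∙ y) ∙ x      ≡⟨ solve 2 (λ x y → ⊖ x ⊕ (x ⊕ y) ⊕ x ⊜ y ⊕ x) refl x y ⟩
        y ∙ x                   ∎
        where open ≡.≡-Reasoning
      y²x : Comm x (y ∙ y)
      y²x = trans (sym (assoc x y y)) (trans (cong (_∙ y) eq) (trans (assoc y (x ⁻¹) y)
        (trans (cong (y ∙_) x⁻¹y) (sym (assoc y y x)))))
    ... | inj₂ (q , r) with refl ← successor p q | refl ← toℕ-injective r =
      contradiction (trans (cong (a k ∙_) (∙-cancelˡ (a l) _ _ eq)) (inverseʳ _)) (square≢ε k)
    cases (gen i) (diff j j′ p) (diff k k′ q) eq in-u in-v in-w
      with refl ← toℕ-injective (two-edges-cover
             (Sum.swap (in-v (inj₁ refl))) (Sum.swap (in-v (inj₂ refl)))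
             (Sum.swap (in-w (inj₁ refl))) (Sum.swap (in-w (inj₂ refl))))
      with refl ← successor p q = contradiction (fixed⇒square≡ε eq) (square≢ε i)
    cases (diff j j′ p) (gen i) (diff k k′ q) eq in-u in-v in-w
      with refl ← toℕ-injective (two-edges-cover
             (Sum.swap (in-u (inj₁ refl))) (Sum.swap (in-u (inj₂ refl)))
             (in-w (inj₁ refl)) (in-w (inj₂ refl)))
      with refl ← successor p q = contradiction (fixed⇒square≡ε′ eq) (square≢ε i)
    cases (diff j j′ p) (diff k k′ q) (gen i) eq in-u in-v in-w
      with refl ← toℕ-injective (two-edges-cover (in-u (inj₁ refl)) (in-u (inj₂ refl))
                    (in-v (inj₁ refl)) (in-v (inj₂ refl)))
      -- Both differences are the same b, and b² = aᵢ with i an end of its edge. So b commutes with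
      -- aᵢ; as b and aᵢ yield the generator at the other end, the two ends commute.
      with refl ← successor p q = ⊥-elim (end (Sum.reduce (in-w refl)))
      where
      b : Fin n
      b = a j′ ∙ a j ⁻¹
      b∙a : a j′ ≡ b ∙ a j
      b∙a = solve 2 (λ x y → y ⊜ (y ⊕ ⊖ x) ⊕ x) refl (a j) (a j′)
      b-comm : Comm b (a i)
      b-comm = comm-resp refl eq (comm-∙ refl refl)
      end : End (toℕ i) (toℕ j) → ⊥
      end (inj₁ r) with refl ← toℕ-injective r =
        not-commuting p (comm-resp refl (sym b∙a) (comm-∙ (sym b-comm) refl))
      end (inj₂ r) with refl ← successor p r = not-commuting p (sym (comm-resp refl
        (solve 2 (λ x y → ⊖ (y ⊕ ⊖ x) ⊕ y ⊜ x) refl (a j) (a j′))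
        (comm-∙ (comm-⁻¹ (sym b-comm)) refl)))
    cases (diff i i′ p) (diff j j′ q) (diff k k′ r) eq in-u in-v in-w
      with i≡j , j≡k ← three-edges-cover (in-u (inj₁ refl)) (in-u (inj₂ refl))
             (in-v (inj₁ refl)) (in-v (inj₂ refl)) (in-w (inj₁ refl)) (in-w (inj₂ refl))
      with refl ← toℕ-injective i≡j | refl ← toℕ-injective j≡k
      with refl ← successor p q | refl ← successor p r =
      contradiction (idempotent⇒square≡ε eq) (diff²≢ε p)

  -- Mutually inverse elements involve the same indices, so u and v are the same generator or the
  -- same difference, and its square would be `ε`.
  antisymmetric : ∀ u v → val u ≢ val v ⁻¹
  antisymmetric u v eq = cases u v eq in-u in-v
    where
    in-u : ∀ {m} → Touches m u → Touches m v
    in-u m∈ = Sum.reduce (shared u v v (λ v∈ _ → subst (Without _) (sym eq) (gen-inv v∈)) m∈)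
    in-v : ∀ {m} → Touches m v → Touches m u
    in-v m∈ = Sum.reduce (shared v u u (λ u∈ _ → subst (Without _)
      (trans (cong _⁻¹ eq) (solve 1 (λ v → ⊖ ⊖ v ⊜ v) refl (val v))) (gen-inv u∈)) m∈)

    inverse⇒square≡ε : ∀ {x} → x ≡ x ⁻¹ → x ∙ x ≡ ε
    inverse⇒square≡ε {x} q = trans (cong (x ∙_) q) (inverseʳ x)

    cases : ∀ u v → val u ≡ val v ⁻¹ → (∀ {m} → Touches m u → Touches m v) →
            (∀ {m} → Touches m v → Touches m u) → ⊥
    cases (gen i) (gen j) eq in-u in-v with refl ← toℕ-injective (in-u refl) =
      square≢ε i (inverse⇒square≡ε eq)
    cases (gen i) (diff j j′ p) eq in-u in-v =
      ℕ.1+n≢n (trans (in-v (inj₂ refl)) (sym (in-v (inj₁ refl))))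
    cases (diff j j′ p) (gen i) eq in-u in-v =
      ℕ.1+n≢n (trans (in-u (inj₂ refl)) (sym (in-u (inj₁ refl))))
    cases (diff i i′ p) (diff j j′ q) eq in-u in-v
      with refl ← toℕ-injective (same-edge (in-u (inj₁ refl)) (in-u (inj₂ refl)))
      with refl ← successor p q = diff²≢ε p (inverse⇒square≡ε eq)

  -- The path is preserved, hence fixed pointwise: it cannot be shifted along itself.
  module Rigid (f : Fin n → Fin n) (f-vertex : ∀ u → ∃[ v ] val v ≡ f (val u))
               (f-arc : ∀ {u v} → (∃[ w ] val w ∙ val u ≡ val v) →
                        ∃[ w ] val w ∙ f (val u) ≡ f (val v)) where

    -- The arc from aᵢ to aᵢ₊₁ goes to an arc between out-neighbours of `ε`, which again belongs to
    -- the path; in particular both images are generators and not differences.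
    f-step : ∀ i j → toℕ j ≡ suc (toℕ i) →
             ∃[ k ] ∃[ l ] f (a i) ≡ a k × f (a j) ≡ a l × toℕ l ≡ suc (toℕ k)
    f-step i j p
      with u , u≡ ← f-vertex (gen i)
      with v , v≡ ← f-vertex (gen j)
      with w , eq ← f-arc {gen i} {gen j} (diff i j p ,
             solve 2 (λ x y → (y ⊕ ⊖ x) ⊕ x ⊜ y) refl (a i) (a j))
      with k , l , refl , refl , q ← arcs-in-connection-set w u v
             (trans (cong (val w ∙_) u≡) (trans eq (sym v≡)))
      = k , l , sym u≡ , sym v≡ , q

    fixes-generators : ∀ i → f (a i) ≡ a i
    fixes-generators = no-shift (λ i k → f (a i) ≡ a k)
      (λ p q → a-injective (trans (sym p) q)) f-step some-index
      where
      -- An image that is a difference still exhibits an arc of the path.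
      some-index : ∀ i → (∃[ k ] f (a i) ≡ a k) ⊎ (∃[ i ] ∃[ j ] toℕ j ≡ suc (toℕ i))
      some-index i with f-vertex (gen i)
      ... | gen k , eq      = inj₁ (k , sym eq)
      ... | diff i j p , eq = inj₂ (i , j , p)

  open Rigid using (fixes-generators)

  -- Automorphisms of the Cayley digraph

  IsVertex : Fin n → Set
  IsVertex g = ∃[ u ] val u ≡ g

  isVertex? : Decidable IsVertex
  isVertex? g = map′
    [ (λ { (i , eq) → gen i , eq }) , (λ { (i , j , p , eq) → diff i j p , eq }) ]
    (λ { (gen i , eq) → inj₁ (i , eq) ; (diff i j p , eq) → inj₂ (i , j , p , eq) })
    (any? (λ i → a i Fin.≟ g) ⊎-dec
     any? (λ i → any? (λ j → (toℕ j ℕ.≟ suc (toℕ i)) ×-dec (a j ∙ a i ⁻¹ Fin.≟ g))))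

  admits-ORR : AdmitsORR G
  admits-ORR = subsetOf isVertex? , oriented , regular
    where
    oriented : ∀ g → g ∈ subsetOf isVertex? → g ⁻¹ ∉ subsetOf isVertex?
    oriented g g∈ g⁻¹∈
      with u , refl ← ∈-subsetOf⁻ isVertex? g∈ | v , eq ← ∈-subsetOf⁻ isVertex? g⁻¹∈
      = antisymmetric v u eq

    -- Moving the out-neighbours of x and of φ(x) back to those of `ε` by right translations gives a
    -- map f that satisfies `Rigid`. Hence φ(aᵢx) = aᵢφ(x) for every x, by induction φ(hx) = hφ(x)
    -- for all h, and x = `ε` shows that φ is right translation by φ(ε).
    regular : AutIsRegular G (subsetOf isVertex?)
    regular π aut = φ ε , λ x → trans (cong φ (sym (identityʳ x))) (translates (generates x) ε)
      where
      φ : Fin n → Fin n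
      φ = π ⟨$⟩ʳ_

      arc⇒arc : ∀ {x y} → IsVertex (y ∙ x ⁻¹) → IsVertex (φ y ∙ φ x ⁻¹)
      arc⇒arc {x} {y} = ∈-subsetOf⁻ isVertex? ∘ Equivalence.to (aut x y) ∘ ∈-subsetOf⁺ isVertex?

      translates-generator : ∀ i x → φ (a i ∙ x) ≡ a i ∙ φ x
      translates-generator i x = begin
        φ (a i ∙ x)    ≡⟨ solve 2 (λ y z → y ⊜ y ⊕ ⊖ z ⊕ z) refl (φ (a i ∙ x)) (φ x) ⟩
        f (a i) ∙ φ x  ≡⟨ cong (_∙ φ x) (fixes-generators f f-vertex (λ {u} {v} → f-arc {u} {v}) i) ⟩
        a i ∙ φ x      ∎
        where
        open ≡.≡-Reasoning
        f : Fin n → Fin n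
        f s = φ (s ∙ x) ∙ φ x ⁻¹

        f-vertex : ∀ u → IsVertex (f (val u))
        f-vertex u = arc⇒arc (u , solve 2 (λ u x → u ⊜ u ⊕ x ⊕ ⊖ x) refl (val u) x)

        f-arc : ∀ {u v} → (∃[ w ] val w ∙ val u ≡ val v) → ∃[ w ] val w ∙ f (val u) ≡ f (val v)
        f-arc {u} {v} (w , eq)
          with w′ , eq′ ← arc⇒arc {val u ∙ x} {val v ∙ x} (w , trans
                 (solve 3 (λ w u x → w ⊜ (w ⊕ u) ⊕ x ⊕ ⊖ (u ⊕ x)) refl (val w) (val u) x)
                 (cong (λ y → y ∙ x ∙ (val u ∙ x) ⁻¹) eq))
          = w′ , trans (cong (_∙ f (val u)) eq′)
              (solve 3 (λ p q r → (q ⊕ ⊖ p) ⊕ (p ⊕ ⊖ r) ⊜ q ⊕ ⊖ r) refl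
                (φ (val u ∙ x)) (φ (val v ∙ x)) (φ x))

      translates : ∀ {h} → Gen G (Range G a) h → ∀ x → φ (h ∙ x) ≡ h ∙ φ x
      translates (gen-base (i , refl)) x = translates-generator i x
      translates gen-ε x = trans (cong φ (identityˡ x)) (sym (identityˡ (φ x)))
      translates (gen-mul {g} {h} p q) x = begin
        φ (g ∙ h ∙ x)    ≡⟨ cong φ (assoc g h x) ⟩
        φ (g ∙ (h ∙ x))  ≡⟨ translates p (h ∙ x) ⟩
        g ∙ φ (h ∙ x)    ≡⟨ cong (g ∙_) (translates q x) ⟩
        g ∙ (h ∙ φ x)    ≡⟨ assoc g h (φ x) ⟨
        g ∙ h ∙ φ x      ∎
        where open ≡.≡-Reasoning
      translates (gen-inv {g} p) x = ∙-cancelˡ g _ _ (begin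
        g ∙ φ (g ⁻¹ ∙ x)    ≡⟨ translates p (g ⁻¹ ∙ x) ⟨
        φ (g ∙ (g ⁻¹ ∙ x))  ≡⟨ cong φ (solve 2 (λ g x → g ⊕ (⊖ g ⊕ x) ⊜ x) refl g x) ⟩
        φ x                 ≡⟨ solve 2 (λ g x → x ⊜ g ⊕ (⊖ g ⊕ x)) refl g (φ x) ⟩
        g ∙ (g ⁻¹ ∙ φ x)    ∎)
        where open ≡.≡-Reasoning

  good-gen-seq : GoodGenSeq G a
  good-gen-seq = a-injective , (generates , irredundant) ,
    (λ i → square≢ε⇒order>2 G (square≢ε i)) , (λ i j p → square≢ε⇒order>2 G (diff²≢ε p))
    where
    irredundant : ∀ s → Range G a s → ¬ Generates G (λ g → Range G a g × g ≢ s)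
    irredundant s (k , refl) spans = independent k (generates-bind G
      (λ { ((i , refl) , ai≢ak) → gen-base (i , (λ { refl → ai≢ak refl }) , refl) }) spans)

theorem6p2 : (G : FinGroup) → ¬ Solvable G
    → (∃[ d ] ∃[ a ] GoodGenSeq G {d} a) × AdmitsORR G
theorem6p2 G non-solvable
  with R , rad , saturated ← radical G
  with d , a , basis ← linked-basis G rad saturated
         -- The zeroth derived subgroup is all of `G`, so R = G would make `G` solvable.
         (λ all∈R → non-solvable (solvable-from G (SolvableNormal.solvable rad) 0 (λ {g} _ → all∈R g)))
  = (d , a , good-gen-seq) , admits-ORR
  where open PathConnectionSet G a basis
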